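{- For every odd integer $t\geq 7$, $$\mathrm{La}(n,\mathcal{O}_{2t})=(1+o(1))\binom{n}{\lfloor n/2\rfloor}\qquad\text{as } n\to\infty.$$
   Context: For posets $P=(P,\le)$ and $P'=(P',\le')$, $P'$ is a (weak) subposet of $P$ if there is an injection $f\colon P'\to P$ such that $u\le' v$ implies $f(u)\le f(v)$. A family $\mathcal{F}$ of subsets of $[n]=\{1,\dots,n\}$ is $P$-free if $P$ is not a weak subposet of $(\mathcal{F},\subseteq)$. $\mathrm{La}(n,P)$ denotes the largest size of a $P$-free family of subsets of $[n]$. For $t\ge 2$, the crown $\mathcal{O}_{2t}$ is the height-2 poset whose Hasse diagram is a cycle of length $2t$ (i.e. elements $a_1,\dots,a_t,b_1,\dots,b_t$ with $a_i<b_i$ and $a_{i+1}<b_i$ for all $i$, indices mod $t$, and no other relations). -}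

module Defs where

open import Data.Nat using (ℕ; zero; suc; _+_; _*_; _≤_; _/_)
open import Data.Nat.Combinatorics using (_C_)
open import Data.Fin using (Fin; toℕ)
open import Data.Fin.Subset using (Subset; _⊆_)
open import Data.List using (List; length; lookup)
open import Data.List.Relation.Unary.Unique.Propositional using (Unique)
open import Data.Sum using (_⊎_; inj₁; inj₂)
open import Data.Product using (_×_; Σ; ∃)
open import Relation.Binary.PropositionalEquality using (_≡_)
open import Relation.Nullary using (¬_)
open import Function.Definitions using (Injective)

record Family (n : ℕ) : Set where
  constructor family
  field
    sets   : List (Subset n)
    unique : Unique sets

open Family public

size : ∀ {n} → Family n → ℕ
size F = length (sets F)

member : ∀ {n} (F : Family n) → Fin (length (sets F)) → Subset n
member F = lookup (sets F)

WeakSubposet : ∀ {n} (X : Set) (_≤P_ : X → X → Set) → Family n → Set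
WeakSubposet X _≤P_ F =
  Σ (X → Fin (length (sets F))) λ f →
    Injective _≡_ _≡_ f × (∀ u v → u ≤P v → member F (f u) ⊆ member F (f v))

Free : ∀ {n} (X : Set) (_≤P_ : X → X → Set) → Family n → Set
Free X _≤P_ F = ¬ WeakSubposet X _≤P_ F

NextMod : (t : ℕ) → Fin t → Fin t → Set
NextMod t i j = (suc (toℕ i) ≡ toℕ j) ⊎ (suc (toℕ i) ≡ t × toℕ j ≡ 0)

-- The crown O_{2t}: elements a_i = inj₁ i, b_i = inj₂ i (i : Fin t);
-- relations: reflexivity, a_i ≤ b_i, a_{i+1} ≤ b_i (indices mod t).
CrownElt : ℕ → Set
CrownElt t = Fin t ⊎ Fin t

data CrownLe (t : ℕ) : CrownElt t → CrownElt t → Set where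
  crefl : ∀ x → CrownLe t x x
  a≤b   : ∀ i → CrownLe t (inj₁ i) (inj₂ i)
  a'≤b  : ∀ i j → NextMod t i j → CrownLe t (inj₁ j) (inj₂ i)

CrownFree : ∀ {n} (t : ℕ) → Family n → Set
CrownFree t F = Free (CrownElt t) (CrownLe t) F

midBinom : ℕ → ℕ
midBinom n = n C (n / 2)

{-# OPTIONS --safe #-}

-- Upper bound: write F for the family. Averaging |C ∩ F| over random maximal chains C (LYM) shows that, if F exceeds
-- (1 + ε) C(n,⌊n/2⌋), then a positive proportion of chains carry two members A ⊂ B of F; a chain never carries 2t of them,
-- or it would contain the crown. Choose a chain below B and move a random element x of the bottom of the chain
-- to the top: the distribution is unchanged, so on a positive proportion of chains three bottom elements x, y, z
-- satisfy: some chain set together with x, y, z is in F, and for each two of x, y, z some smaller chain set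
-- together with these two is in F. By symmetry such "good" triples have positive density, independent of n, in any three
-- fixed blocks of positions off the chain, so some chain has a complete tripartite 3-graph of good triples,
-- and a closed walk of odd length t ≥ 7 in the grid of its triples spells a crown.

module Submission where

open import Data.Bool using (Bool; true; false; _∧_; _∨_; not) renaming (_≟_ to _≟ᵇ_)
open import Data.Empty using (⊥; ⊥-elim)
open import Data.List using (List; []; _∷_; _++_; length; map; concatMap; take; drop; filter; lookup; tabulate; allFin; upTo; applyUpTo)
open import Data.List.Properties using (length-map; length-tabulate; map-tabulate; map-∘; length-upTo; map-upTo; length-++; take++drop≡id; length-take; ++-assoc; ≡-dec; ∷-injectiveˡ; ∷-injectiveʳ)
open import Data.List.Membership.Propositional using (_∈_; find; lose)
open import Data.List.Membership.Propositional.Properties using (∈-map⁻; ∈-map⁺; ∈-++⁺ˡ; ∈-++⁺ʳ; ∈-++⁻; ∈-upTo⁻; ∈-allFin; ∈-lookup; ∈-filter⁻; ∈-upTo⁺; ∈-concat⁻′; ∈-concatMap⁺; ∈-concatMap⁻)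
import Data.List.Relation.Unary.Any as Any
open import Data.List.Relation.Unary.Any using (here; there)
open import Data.List.Relation.Unary.All as All using (All; []; _∷_)
open import Data.List.Relation.Unary.AllPairs using ([]; _∷_)
open import Data.List.Relation.Unary.Any.Properties using (lookup-index)
open import Data.List.Relation.Unary.Unique.Propositional using (Unique)
import Data.List.Relation.Unary.Unique.Propositional.Properties as Unique
import Data.List.Membership.DecPropositional as DecMembership
open import Data.List.Relation.Binary.Permutation.Propositional using (_↭_; ↭⇒↭ₛ; ↭-refl; ↭-sym; ↭-trans; prep; swap)
open import Data.List.Relation.Binary.Permutation.Propositional.Properties using (shift; ↭-length; ++⁺ʳ; drop-∷; ∈-resp-↭; map⁺)
open import Data.Fin as Fin using (Fin; toℕ)
open import Data.Fin.Properties using (toℕ-injective; toℕ<n)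
open import Data.Fin.Subset using (Subset; ⁅_⁆; _∪_; ∣_∣; _⊆_) renaming (_∈_ to _∈ˢ_; ⊥ to ∅)
open import Data.Fin.Subset.Properties using (x∈⁅x⁆; x∈⁅y⁆⇒x≡y; x∈p∪q⁺; x∈p∪q⁻; ∉⊥; ∣p∣≤n; drop-∷-⊆; p⊆q⇒∣p∣≤∣q∣; ⊆-antisym)
open import Data.List.Relation.Binary.Permutation.Setoid.Properties using (Unique-resp-↭)
open import Data.Maybe using (Maybe; just; nothing)
open import Data.Nat using (ℕ; zero; suc; _+_; _*_; _∸_; _≤_; _<_; z≤n; s≤s; _!; _/_; _≤?_; _<?_; _⊓_; >-nonZero; >-nonZero⁻¹)
open import Data.Nat.ListAction using (sum)
open import Data.Nat.Combinatorics using (_C_; nCk≡n!/k![n-k]!; nCn≡1; nCk≡nC[n∸k]; k>n⇒nCk≡0; k![n∸k]!∣n!; nCk+nC[k+1]≡[n+1]C[k+1])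
open import Data.Nat.DivMod using (m/n*n≡m; m/n*n≤m; m/n≤m; /-mono-≤; m*n/n≡m)
open import Data.Nat.ListAction.Properties using (sum-↭)
open import Data.Nat.Properties
open import Relation.Binary.Definitions using (tri<; tri≈; tri>)
open import Data.Nat.Tactic.RingSolver using (solve-∀)
open import Data.Vec as Vec using ([]; _∷_)
import Data.Vec.Properties as Vec
open import Data.Product using (Σ; Σ-syntax; ∃; ∃-syntax; _×_; _,_; proj₁; proj₂)
open import Data.Sum using (_⊎_; inj₁; inj₂)
open import Function using (_∘_; id)
open import Relation.Binary.PropositionalEquality using (_≡_; _≢_; refl; sym; trans; cong; cong₂; subst; subst₂; setoid; module ≡-Reasoning)
open import Relation.Nullary using (¬_; ¬?; Dec; yes; no; does; _×-dec_)
open import Relation.Nullary.Decidable using (dec-true; dec-false)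
open import Data.Unit using (⊤; tt)
open import Defs

-- A grid point, that is three off-chain elements together with a chain set, serves as an upper
-- element of the crown; an axis-parallel line, which keeps only two of the elements and takes a
-- smaller chain set, serves as a lower one. Neighbouring points of the closed walk share a line,
-- and all points and lines have to be distinct, so two consecutive steps never have the same
-- direction. With two directions they would alternate and the length would be even: this is why
-- triples are needed. In a closed walk a direction that occurs at all occurs at least twice, since
-- a single step along it is never undone; so an odd walk uses three directions and has at least 7
-- steps.
--
-- Two cuts on the sizes make the argument work. Without members of size below `r`, a member on the
-- chain that has lost one bottom element still contains all the other bottom elements, which makes
-- the information from three different moves compatible. Without members of size above `n ∸ M`, the
-- last `M` positions lie beyond every chain set and can carry the grid. Both cuts discard a bounded
-- number of levels far from the middle.

private variable
  A B : Set
  n t : ℕ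

-- Finite sums, indicators and averaging

χ : Bool → ℕ
χ true  = 1
χ false = 0

χ≤1 : ∀ b → χ b ≤ 1
χ≤1 true  = ≤-refl
χ≤1 false = z≤n

∑ : List A → (A → ℕ) → ℕ
∑ l f = sum (map f l)

∑-mono : (l : List A) {f g : A → ℕ} → (∀ {x} → x ∈ l → f x ≤ g x) → ∑ l f ≤ ∑ l g
∑-mono []      f≤g = z≤n
∑-mono (x ∷ l) f≤g = +-mono-≤ (f≤g (here refl)) (∑-mono l (f≤g ∘ there))

∑-cong : (l : List A) {f g : A → ℕ} → (∀ {x} → x ∈ l → f x ≡ g x) → ∑ l f ≡ ∑ l g
∑-cong l f≡g = ≤-antisym (∑-mono l (≤-reflexive ∘ f≡g)) (∑-mono l (≤-reflexive ∘ sym ∘ f≡g))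

∑-+ : (l : List A) (f g : A → ℕ) → ∑ l (λ x → f x + g x) ≡ ∑ l f + ∑ l g
∑-+ []      f g = refl
∑-+ (x ∷ l) f g rewrite ∑-+ l f g = lemma (f x) (g x) (∑ l f) (∑ l g)
  where
  lemma : ∀ a b c d → (a + b) + (c + d) ≡ (a + c) + (b + d)
  lemma = solve-∀

∑-* : (l : List A) (c : ℕ) (f : A → ℕ) → ∑ l (λ x → c * f x) ≡ c * ∑ l f
∑-* []      c f = sym (*-zeroʳ c)
∑-* (x ∷ l) c f rewrite ∑-* l c f = sym (*-distribˡ-+ c (f x) (∑ l f))

∑-const : (l : List A) (c : ℕ) → ∑ l (λ _ → c) ≡ length l * c
∑-const []      c = refl
∑-const (x ∷ l) c = cong (c +_) (∑-const l c)

∑-swap : (l : List A) (m : List B) (f : A → B → ℕ) →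
         ∑ l (λ x → ∑ m (f x)) ≡ ∑ m (λ y → ∑ l (λ x → f x y))
∑-swap []      m f = sym (trans (∑-const m 0) (*-zeroʳ (length m)))
∑-swap (x ∷ l) m f = trans (cong (∑ m (f x) +_) (∑-swap l m f)) (sym (∑-+ m (f x) _))

∑-++ : (l m : List A) (f : A → ℕ) → ∑ (l ++ m) f ≡ ∑ l f + ∑ m f
∑-++ []      m f = refl
∑-++ (x ∷ l) m f = trans (cong (f x +_) (∑-++ l m f)) (sym (+-assoc (f x) _ _))

∑-map : (l : List A) (h : A → B) (f : B → ℕ) → ∑ (map h l) f ≡ ∑ l (f ∘ h)
∑-map []      h f = refl
∑-map (x ∷ l) h f = cong (f (h x) +_) (∑-map l h f)

∑-concatMap : (l : List A) (h : A → List B) (f : B → ℕ) →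
              ∑ (concatMap h l) f ≡ ∑ l (λ x → ∑ (h x) f)
∑-concatMap []      h f = refl
∑-concatMap (x ∷ l) h f = trans (∑-++ (h x) (concatMap h l) f) (cong (∑ (h x) f +_) (∑-concatMap l h f))

∑-bound : (l : List A) {f : A → ℕ} {c : ℕ} → (∀ {x} → x ∈ l → f x ≤ c) → ∑ l f ≤ length l * c
∑-bound l f≤c = ≤-trans (∑-mono l f≤c) (≤-reflexive (∑-const l _))

term≤∑ : {l : List A} {x : A} (f : A → ℕ) → x ∈ l → f x ≤ ∑ l f
term≤∑ f (here refl) = m≤m+n _ _
term≤∑ f (there x∈l) = ≤-trans (term≤∑ f x∈l) (m≤n+m _ _)

average : (l : List A) (f : A → ℕ) {c : ℕ} → 0 < length l → length l * c ≤ ∑ l f → ∃[ x ] x ∈ l × c ≤ f x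
average (x ∷ l) f {c} _ big with c ≤? f x
... | yes c≤fx = x , here refl , c≤fx
average (x ∷ [])     f {c} _ big | no c≰fx = ⊥-elim (c≰fx (subst₂ _≤_ (+-identityʳ c) (+-identityʳ (f x)) big))
average (x ∷ y ∷ l)  f {c} _ big | no c≰fx =
  let z , z∈ , c≤fz = average (y ∷ l) f (s≤s z≤n) (+-cancelˡ-≤ c _ _ (≤-trans big (+-monoˡ-≤ _ (<⇒≤ (≰⇒> c≰fx)))))
  in  z , there z∈ , c≤fz

∑-upTo : ∀ n (f : ℕ → ℕ) → ∑ (upTo (suc n)) f ≡ f 0 + ∑ (upTo n) (f ∘ suc)
∑-upTo n f = cong (λ l → f 0 + sum l) (trans (trans (cong (map f) (sym (map-upTo suc n))) (sym (map-∘ (upTo n)))) refl)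

∑-upTo-const : ∀ k {f : ℕ → ℕ} {c} → (∀ i → f i ≡ c) → ∑ (upTo k) f ≡ k * c
∑-upTo-const k eq =
  trans (∑-cong (upTo k) (λ {i} _ → eq i)) (trans (∑-const (upTo k) _) (cong (_* _) (length-upTo k)))

choose : ∀ m n (p : ℕ → Bool) → m ≤ ∑ (upTo n) (χ ∘ p) →
         Σ[ ι ∈ (ℕ → ℕ) ] (∀ {i} → i < m → ι i < n × p (ι i) ≡ true) × (∀ {i j} → i < j → j < m → ι i < ι j)
choose zero    n       p _ = id , (λ ()) , (λ _ ())
choose (suc m) (suc n) p big rewrite ∑-upTo n (χ ∘ p) with p 0 in p0
... | false =
  let ι , good , mono = choose (suc m) n (p ∘ suc) big
  in  suc ∘ ι , (λ i<m → s≤s (proj₁ (good i<m)) , proj₂ (good i<m)) , (λ i<j j<m → s≤s (mono i<j j<m))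
... | true with choose m n (p ∘ suc) (≤-pred big)
...   | ι , good , mono = ι⁺ , good⁺ , mono⁺
  where
  ι⁺ : ℕ → ℕ
  ι⁺ zero    = 0
  ι⁺ (suc i) = suc (ι i)
  good⁺ : ∀ {i} → i < suc m → ι⁺ i < suc n × p (ι⁺ i) ≡ true
  good⁺ {zero}  _         = s≤s z≤n , p0
  good⁺ {suc i} (s≤s i<m) = s≤s (proj₁ (good i<m)) , proj₂ (good i<m)
  mono⁺ : ∀ {i j} → i < j → j < suc m → ι⁺ i < ι⁺ j
  mono⁺ {zero}  {suc j} _         _         = s≤s z≤n
  mono⁺ {suc i} {suc j} (s≤s i<j) (s≤s j<m) = s≤s (mono i<j j<m)

-- Sums over all arrangements of a list

select : List A → List (A × List A)
select []       = []
select (x ∷ xs) = (x , xs) ∷ map (λ (y , ys) → y , x ∷ ys) (select xs)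

select-↭ : {xs ys : List A} {y : A} → (y , ys) ∈ select xs → y ∷ ys ↭ xs
select-↭ {xs = x ∷ xs} (here refl) = ↭-refl
select-↭ {xs = x ∷ xs} (there q) with ∈-map⁻ _ q
... | (y , ys) , q′ , refl = ↭-trans (swap _ _ ↭-refl) (prep _ (select-↭ q′))

length-select : (xs : List A) → length (select xs) ≡ length xs
length-select []       = refl
length-select (x ∷ xs) = cong suc (trans (length-map _ (select xs)) (length-select xs))

-- When `n` is the length of `xs` these are all orderings, one for each way to draw the entries. The
-- prefixes of an ordering form a maximal chain, so a sum over this list is `n !` times an
-- expectation over a random maximal chain.
arrangements : ℕ → List A → List (List A)
arrangements zero    xs = [] ∷ []
arrangements (suc n) xs = concatMap (λ (y , ys) → map (y ∷_) (arrangements n ys)) (select xs)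

∑-arrangements : ∀ n (xs : List A) (f : List A → ℕ) →
  ∑ (arrangements (suc n) xs) f ≡ ∑ (select xs) (λ (y , ys) → ∑ (arrangements n ys) (λ π → f (y ∷ π)))
∑-arrangements n xs f = trans (∑-concatMap (select xs) _ f)
  (∑-cong (select xs) (λ {(y , ys)} _ → ∑-map (arrangements n ys) (y ∷_) f))

arrangements-↭ : ∀ n {xs π : List A} → length xs ≡ n → π ∈ arrangements n xs → π ↭ xs
arrangements-↭ zero    {[]}     eq (here refl) = ↭-refl
arrangements-↭ (suc n) {xs} {π} eq π∈ with ∈-concat⁻′ (map (λ (y , ys) → map (y ∷_) (arrangements n ys)) (select xs)) π∈
... | l , π∈l , l∈ with ∈-map⁻ _ l∈
...   | (y , ys) , sel , refl with ∈-map⁻ _ π∈l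
...     | ρ , ρ∈ , refl =
  ↭-trans (prep y (arrangements-↭ n (suc-injective (trans (↭-length (select-↭ sel)) eq)) ρ∈)) (select-↭ sel)

length-arrangements : ∀ n (xs : List A) → length xs ≡ n → length (arrangements n xs) ≡ n !
length-arrangements zero    xs eq = refl
length-arrangements (suc n) xs eq = begin
  length (arrangements (suc n) xs)                                        ≡⟨ *-identityʳ _ ⟨
  length (arrangements (suc n) xs) * 1                                    ≡⟨ ∑-const (arrangements (suc n) xs) 1 ⟨
  ∑ (arrangements (suc n) xs) (λ _ → 1)                                   ≡⟨ ∑-arrangements n xs _ ⟩
  ∑ (select xs) (λ (y , ys) → ∑ (arrangements n ys) (λ _ → 1))            ≡⟨ ∑-cong (select xs) (λ {(y , ys)} sel →
     trans (∑-const (arrangements n ys) 1) (trans (*-identityʳ _)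
       (length-arrangements n ys (suc-injective (trans (↭-length (select-↭ sel)) eq))))) ⟩
  ∑ (select xs) (λ _ → n !)                                               ≡⟨ ∑-const (select xs) (n !) ⟩
  length (select xs) * n !                                                ≡⟨ cong (_* n !) (trans (length-select xs) eq) ⟩
  suc n * n !                                                             ∎
  where open ≡-Reasoning

-- Invariance under moving an entry to the front

swapHead : List A → List A
swapHead (x ∷ y ∷ l) = y ∷ x ∷ l
swapHead l           = l

toFront : ℕ → List A → List A
toFront zero    l       = l
toFront (suc k) []      = []
toFront (suc k) (x ∷ l) = swapHead (x ∷ toFront k l)

-- For `x ∷ xs`, the pairs that draw `x` first and those that draw it second trade places; the pairs
-- that avoid `x` are left to the induction.
∑-select² : (xs : List A) (g : A → A → List A → ℕ) →
  ∑ (select xs) (λ (y , ys) → ∑ (select ys) (λ (z , zs) → g y z zs)) ≡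
  ∑ (select xs) (λ (y , ys) → ∑ (select ys) (λ (z , zs) → g z y zs))
∑-select² []       g = refl
∑-select² (x ∷ xs) g = begin
  u + ∑ (map _ (select xs)) _                                 ≡⟨ expand g ⟩
  u + (v + w g)                                               ≡⟨ cong (λ r → u + (v + r)) (∑-select² xs _) ⟩
  u + (v + w (λ y z → g z y))                                 ≡⟨ lemma u v _ ⟩
  v + (u + w (λ y z → g z y))                                 ≡⟨ expand (λ y z → g z y) ⟨
  v + ∑ (map _ (select xs)) _                                 ∎
  where
  open ≡-Reasoning
  u = ∑ (select xs) (λ (z , zs) → g x z zs)
  v = ∑ (select xs) (λ (z , zs) → g z x zs)
  w : (_ → _ → _ → ℕ) → ℕ
  w h = ∑ (select xs) (λ (y , ys) → ∑ (select ys) (λ (z , zs) → h y z (x ∷ zs)))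
  lemma : ∀ a b c → a + (b + c) ≡ b + (a + c)
  lemma = solve-∀
  expand : ∀ h → ∑ (select xs) (λ (z , zs) → h x z zs) +
      ∑ (map (λ (y , ys) → y , x ∷ ys) (select xs)) (λ (y , ys) → ∑ (select ys) (λ (z , zs) → h y z zs))
    ≡ ∑ (select xs) (λ (z , zs) → h x z zs) + (∑ (select xs) (λ (z , zs) → h z x zs) + w h)
  expand h = cong (∑ (select xs) (λ (z , zs) → h x z zs) +_)
    (trans (∑-map (select xs) _ _)
    (trans (∑-cong (select xs) (λ {(y , ys)} _ → cong (h y x ys +_) (∑-map (select ys) _ _)))
           (∑-+ (select xs) _ _)))

∑-swapHead : ∀ n (xs : List A) (f : List A → ℕ) → ∑ (arrangements n xs) (f ∘ swapHead) ≡ ∑ (arrangements n xs) f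
∑-swapHead zero          xs f = refl
∑-swapHead (suc zero)    xs f = trans (∑-arrangements 0 xs _) (sym (∑-arrangements 0 xs f))
∑-swapHead (suc (suc n)) xs f = begin
  ∑ (arrangements (2 + n) xs) (f ∘ swapHead)                        ≡⟨ twice (f ∘ swapHead) ⟩
  ∑ (select xs) (λ (y , ys) → ∑ (select ys) (λ (z , zs) → g z y zs)) ≡⟨ ∑-select² xs g ⟨
  ∑ (select xs) (λ (y , ys) → ∑ (select ys) (λ (z , zs) → g y z zs)) ≡⟨ twice f ⟨
  ∑ (arrangements (2 + n) xs) f                                     ∎
  where
  open ≡-Reasoning
  g = λ y z zs → ∑ (arrangements n zs) (λ π → f (y ∷ z ∷ π))
  twice : ∀ h → ∑ (arrangements (2 + n) xs) h ≡
    ∑ (select xs) (λ (y , ys) → ∑ (select ys) (λ (z , zs) → ∑ (arrangements n zs) (λ π → h (y ∷ z ∷ π))))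
  twice h = trans (∑-arrangements (suc n) xs h) (∑-cong (select xs) (λ {(y , ys)} _ → ∑-arrangements n ys _))

-- `toFront k` is a product of adjacent transpositions: the induction brings the entry to the head
-- of the tail, and `swapHead` carries it past the first entry.
∑-toFront : ∀ k n (xs : List A) (f : List A → ℕ) → ∑ (arrangements n xs) (f ∘ toFront k) ≡ ∑ (arrangements n xs) f
∑-toFront zero    n       xs f = refl
∑-toFront (suc k) zero    xs f = refl
∑-toFront (suc k) (suc n) xs f = begin
  ∑ (arrangements (suc n) xs) (f ∘ toFront (suc k))                              ≡⟨ ∑-arrangements n xs _ ⟩
  ∑ (select xs) (λ (y , ys) → ∑ (arrangements n ys) (λ π → f (swapHead (y ∷ toFront k π))))
    ≡⟨ ∑-cong (select xs) (λ {(y , ys)} _ → ∑-toFront k n ys (λ π → f (swapHead (y ∷ π)))) ⟩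
  ∑ (select xs) (λ (y , ys) → ∑ (arrangements n ys) (λ π → f (swapHead (y ∷ π)))) ≡⟨ ∑-arrangements n xs (f ∘ swapHead) ⟨
  ∑ (arrangements (suc n) xs) (f ∘ swapHead)                                     ≡⟨ ∑-swapHead (suc n) xs f ⟩
  ∑ (arrangements (suc n) xs) f                                                  ∎
  where open ≡-Reasoning

toFront-++ : (u : List A) (x : A) (v : List A) → toFront (length u) (u ++ x ∷ v) ≡ x ∷ u ++ v
toFront-++ []      x v = refl
toFront-++ (y ∷ u) x v rewrite toFront-++ u x v = refl

split-at : (k : ℕ) (l : List A) → k < length l → ∃[ u ] ∃[ x ] ∃[ v ] l ≡ u ++ x ∷ v × length u ≡ k
split-at zero    (x ∷ l) _         = [] , x , l , refl , refl
split-at (suc k) (x ∷ l) (s≤s k<l) =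
  let u , y , v , eq , len = split-at k l k<l in x ∷ u , y , v , cong (x ∷_) eq , cong suc len

-- Bounded search and prefixes of lists

∧-true : ∀ {a b} → a ≡ true → b ≡ true → a ∧ b ≡ true
∧-true refl refl = refl

∧-trueˡ : ∀ {a b} → a ∧ b ≡ true → a ≡ true
∧-trueˡ {true} _ = refl

∧-trueʳ : ∀ {a b} → a ∧ b ≡ true → b ≡ true
∧-trueʳ {true} eq = eq

χ-mono : ∀ {a b} → (a ≡ true → b ≡ true) → χ a ≤ χ b
χ-mono {false} a⇒b = z≤n
χ-mono {true}  a⇒b rewrite a⇒b refl = ≤-refl

anyUpTo : ℕ → (ℕ → Bool) → Bool
anyUpTo zero    ψ = ψ 0
anyUpTo (suc n) ψ = ψ 0 ∨ anyUpTo n (ψ ∘ suc)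

anyUpTo⁺ : ∀ {i n} (ψ : ℕ → Bool) → i ≤ n → ψ i ≡ true → anyUpTo n ψ ≡ true
anyUpTo⁺ {n = zero}          ψ z≤n ψi = ψi
anyUpTo⁺ {zero}  {n = suc n} ψ z≤n ψi rewrite ψi = refl
anyUpTo⁺ {suc i} {n = suc n} ψ (s≤s i≤n) ψi with ψ 0
... | true  = refl
... | false = anyUpTo⁺ (ψ ∘ suc) i≤n ψi

anyUpTo⁻ : ∀ n (ψ : ℕ → Bool) → anyUpTo n ψ ≡ true → ∃[ i ] i ≤ n × ψ i ≡ true
anyUpTo⁻ zero    ψ eq = 0 , z≤n , eq
anyUpTo⁻ (suc n) ψ eq with ψ 0 in ψ0
... | true  = 0 , z≤n , ψ0
... | false = let i , i≤n , ψi = anyUpTo⁻ n (ψ ∘ suc) eq in suc i , s≤s i≤n , ψi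

anyUpTo-cong : ∀ n {ψ ψ′ : ℕ → Bool} → (∀ {i} → i ≤ n → ψ i ≡ ψ′ i) → anyUpTo n ψ ≡ anyUpTo n ψ′
anyUpTo-cong zero    eq = eq z≤n
anyUpTo-cong (suc n) eq = cong₂ _∨_ (eq z≤n) (anyUpTo-cong n (eq ∘ s≤s))

-- Only the first hit has no earlier hit. On a chain this turns an excess of members into pairs of
-- nested members.
count≤1+successors : ∀ n (ψ : ℕ → Bool) →
  ∑ (upTo (suc n)) (χ ∘ ψ) ≤ 1 + ∑ (upTo n) (λ j → χ (ψ (suc j) ∧ anyUpTo j ψ))
count≤1+successors n ψ rewrite ∑-upTo n (χ ∘ ψ) with ψ 0 in ψ0
... | true = s≤s (∑-mono (upTo n) (λ {j} _ →
  χ-mono (λ ψj → ∧-true ψj (anyUpTo⁺ ψ (z≤n {j}) ψ0))))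
count≤1+successors zero    ψ | false = z≤n
count≤1+successors (suc n) ψ | false
  rewrite ∑-upTo n (λ j → χ (ψ (suc j) ∧ anyUpTo j ψ)) | ψ0 =
  ≤-trans (count≤1+successors n (ψ ∘ suc)) (s≤s (m≤n+m _ (χ (ψ 1 ∧ false))))

take-++≤ : ∀ {k} (u v : List A) → k ≤ length u → take k (u ++ v) ≡ take k u
take-++≤ {k = zero}  u       v _         = refl
take-++≤ {k = suc k} (x ∷ u) v (s≤s k≤u) = cong (x ∷_) (take-++≤ u v k≤u)

take-+++ : ∀ d (u v : List A) → take (length u + d) (u ++ v) ≡ u ++ take d v
take-+++ d []      v = refl
take-+++ d (x ∷ u) v = cong (x ∷_) (take-+++ d u v)

length-take≤ : ∀ k (l : List A) → length (take k l) ≤ k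
length-take≤ k l = ≤-trans (≤-reflexive (length-take k l)) (m⊓n≤m k _)

swapHead-↭ : (l : List A) → swapHead l ↭ l
swapHead-↭ []          = ↭-refl
swapHead-↭ (x ∷ [])    = ↭-refl
swapHead-↭ (x ∷ y ∷ l) = swap y x ↭-refl

toFront-↭ : ∀ k (l : List A) → toFront k l ↭ l
toFront-↭ zero    l       = ↭-refl
toFront-↭ (suc k) []      = ↭-refl
toFront-↭ (suc k) (x ∷ l) = ↭-trans (swapHead-↭ (x ∷ toFront k l)) (prep x (toFront-↭ k l))

toFront-++ˡ : ∀ k (u v : List A) → k < length u → toFront k (u ++ v) ≡ toFront k u ++ v
toFront-++ˡ k u v k<u with split-at k u k<u
... | α , x , β , refl , refl = begin
  toFront (length α) ((α ++ x ∷ β) ++ v)   ≡⟨ cong (toFront (length α)) (++-assoc α (x ∷ β) v) ⟩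
  toFront (length α) (α ++ x ∷ β ++ v)     ≡⟨ toFront-++ α x (β ++ v) ⟩
  x ∷ α ++ β ++ v                          ≡⟨ cong (x ∷_) (++-assoc α β v) ⟨
  (x ∷ α ++ β) ++ v                        ≡⟨ cong (_++ v) (toFront-++ α x β) ⟨
  toFront (length α) (α ++ x ∷ β) ++ v     ∎
  where open ≡-Reasoning

take-toFront-↭ : ∀ {k j} (l : List A) → k ≤ j → j < length l → take (suc j) (toFront k l) ↭ take (suc j) l
take-toFront-↭ {k = k} {j} l k≤j j<l with split-at k l (≤-<-trans k≤j j<l)
... | u , x , v , refl , refl with m≤n⇒∃[o]m+o≡n k≤j
...   | d , refl
  rewrite toFront-++ u x v | take-+++ d u v | sym (+-suc (length u) d) | take-+++ (suc d) u (x ∷ v)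
  = ↭-sym (shift x u (take d v))

-- Extraction of three entries

-- For p < q < s each move pushes the entries that it passes one place back, hence the offsets 1 and
-- 2; the three entries end up in front in their old order. As a composition of `toFront`s it
-- preserves sums over arrangements.
triple : ℕ → ℕ → ℕ → List A → List A
triple p q s l = toFront (2 + p) (toFront (1 + q) (toFront s l))

split₃ : ∀ {p q s} (l : List A) → p < q → q < s → s < length l →
  ∃[ α ] ∃[ x ] ∃[ β ] ∃[ y ] ∃[ γ ] ∃[ z ] ∃[ δ ]
    l ≡ ((α ++ x ∷ β) ++ y ∷ γ) ++ z ∷ δ × length α ≡ p × length (α ++ x ∷ β) ≡ q × length ((α ++ x ∷ β) ++ y ∷ γ) ≡ s
split₃ {p = p} {q} {s} l p<q q<s s<l with split-at s l s<l
... | u , z , δ , refl , refl with split-at q u q<s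
...   | u′ , y , γ , refl , refl with split-at p u′ p<q
...     | α , x , β , refl , refl = α , x , β , y , γ , z , δ , refl , refl , refl , refl

triple-split : (α : List A) (x : A) (β : List A) (y : A) (γ : List A) (z : A) (δ : List A) →
  triple (length α) (length (α ++ x ∷ β)) (length ((α ++ x ∷ β) ++ y ∷ γ)) (((α ++ x ∷ β) ++ y ∷ γ) ++ z ∷ δ)
  ≡ x ∷ y ∷ z ∷ α ++ β ++ γ ++ δ
triple-split α x β y γ z δ
  rewrite toFront-++ ((α ++ x ∷ β) ++ y ∷ γ) z δ
        | ++-assoc (α ++ x ∷ β) (y ∷ γ) δ
        | toFront-++ (α ++ x ∷ β) y (γ ++ δ)
        | ++-assoc α (x ∷ β) (γ ++ δ)
        | toFront-++ α x (β ++ γ ++ δ) = refl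

-- `lx`, `ly` and `lz` are `l` with one of the three entries taken out. Each is a rearrangement of
-- the other two entries and the common `rest`, which brings the sets seen after three different
-- moves into one form.
record Extracted (p q s : ℕ) (l : List A) : Set where
  field
    x y z    : A
    rest     : List A
    lx ly lz : List A
    triple≡  : triple p q s l ≡ x ∷ y ∷ z ∷ rest
    frontˣ   : toFront p l ≡ x ∷ lx
    frontʸ   : toFront q l ≡ y ∷ ly
    frontᶻ   : toFront s l ≡ z ∷ lz
    lx↭      : lx ↭ y ∷ z ∷ rest
    ly↭      : ly ↭ x ∷ z ∷ rest
    lz↭      : lz ↭ x ∷ y ∷ rest

extract : ∀ {p q s} (l : List A) → p < q → q < s → s < length l → Extracted p q s l
extract {p = p} {q} {s} l p<q q<s s<l with split₃ l p<q q<s s<l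
... | α , x , β , y , γ , z , δ , refl , refl , refl , refl = record
  { triple≡ = triple-split α x β y γ z δ
  ; frontˣ = fx ; frontʸ = fy ; frontᶻ = fz
  ; lx↭ = drop-∷ (↭-trans (subst (_↭ l) fx (toFront-↭ (length α) l)) l↭)
  ; ly↭ = drop-∷ (↭-trans (↭-trans (subst (_↭ l) fy (toFront-↭ (length (α ++ x ∷ β)) l)) l↭) (swap x y ↭-refl))
  ; lz↭ = drop-∷ (↭-trans (↭-trans (subst (_↭ l) fz (toFront-↭ (length ((α ++ x ∷ β) ++ y ∷ γ)) l)) l↭)
                 (↭-trans (prep x (swap y z ↭-refl)) (swap x z ↭-refl)))
  }
  where
  fx : toFront (length α) l ≡ x ∷ α ++ (β ++ y ∷ γ) ++ z ∷ δ
  fx = trans (cong (toFront (length α))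
         (trans (cong (_++ z ∷ δ) (++-assoc α (x ∷ β) (y ∷ γ))) (++-assoc α (x ∷ β ++ y ∷ γ) (z ∷ δ))))
         (toFront-++ α x _)
  fy : toFront (length (α ++ x ∷ β)) l ≡ y ∷ (α ++ x ∷ β) ++ γ ++ z ∷ δ
  fy = trans (cong (toFront (length (α ++ x ∷ β))) (++-assoc (α ++ x ∷ β) (y ∷ γ) (z ∷ δ))) (toFront-++ (α ++ x ∷ β) y _)
  fz = toFront-++ ((α ++ x ∷ β) ++ y ∷ γ) z δ
  l↭ : l ↭ x ∷ y ∷ z ∷ α ++ β ++ γ ++ δ
  l↭ = ↭-sym (subst (_↭ l) (triple-split α x β y γ z δ)
    (↭-trans (toFront-↭ (2 + length α) _) (↭-trans (toFront-↭ (1 + length (α ++ x ∷ β)) _)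
      (toFront-↭ (length ((α ++ x ∷ β) ++ y ∷ γ)) l))))

-- Density of good triples in a random chain

-- `φ l` will say that the entries of `l` form a member of the family with size between `r` and `L`;
-- hence the invariance under permutation.
module Averaging {A : Set} (φ : List A → Bool) (φ-↭ : ∀ {l m} → l ↭ m → φ l ≡ φ m)
  (r L : ℕ) (r≤ : ∀ l → φ l ≡ true → r ≤ length l) (≤L : ∀ l → φ l ≡ true → length l ≤ L) where

  levels : List A → ℕ
  levels π = ∑ (upTo (length π)) (λ j → χ (φ (take (suc j) π)))

  upper : ℕ → List A → Bool
  upper j π = φ (take (suc j) π) ∧ anyUpTo j (λ i → φ (take i π))

  -- Has the same sum over all arrangements as `upper j`, also after any position has been moved to the front.
  upper⁻ : ℕ → List A → Bool
  upper⁻ j π = φ (take (suc j) π) ∧ anyUpTo j (λ i → φ (take i (drop 1 π)))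

  good : List A → Bool
  good (x ∷ y ∷ z ∷ c) = anyUpTo L (λ j → φ (x ∷ y ∷ z ∷ take j c) ∧
    (anyUpTo j (λ i → φ (y ∷ z ∷ take i c)) ∧
    (anyUpTo j (λ i → φ (x ∷ z ∷ take i c)) ∧
     anyUpTo j (λ i → φ (x ∷ y ∷ take i c)))))
  good _ = false

  -- The entry brought to the front leaves the `j` entries before it in their order, so dropping it
  -- gives back the old prefixes of length up to `j`.
  upper⁻-toFront : ∀ j π → j < length π → upper⁻ j (toFront j π) ≡ upper j π
  upper⁻-toFront j π j<π = cong₂ _∧_ (φ-↭ (take-toFront-↭ π ≤-refl j<π)) (anyUpTo-cong j (λ i≤j → cong φ (below i≤j)))
    where
    below : ∀ {i} → i ≤ j → take i (drop 1 (toFront j π)) ≡ take i π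
    below i≤j with split-at j π j<π
    ... | u , x , v , refl , refl rewrite toFront-++ u x v | take-++≤ u v i≤j | take-++≤ u (x ∷ v) i≤j = refl

  -- The member found has at least `r` elements and is a prefix of `lx ++ c`, while `lx` has only
  -- `r` - 1 entries. So it contains all of `lx`, in particular `v` and `w`, and the rest of it is a
  -- prefix of `rest ++ c`.
  pair-survives : ∀ {d e v w} (rest lx c : List A) → lx ↭ v ∷ w ∷ rest → suc (length lx) ≡ r → length lx + d ≡ e →
    anyUpTo e (λ i → φ (take i (lx ++ c))) ≡ true →
    anyUpTo (length rest + d) (λ i → φ (v ∷ w ∷ take i (rest ++ c))) ≡ true
  pair-survives {d} {v = v} {w} rest lx c lx↭ len refl any with anyUpTo⁻ (length lx + d) _ any
  ... | i , i≤ , φi with m≤n⇒∃[o]m+o≡n (≤-trans (≤-trans (n≤1+n _) (≤-trans (≤-reflexive len) (r≤ _ φi))) (length-take≤ i (lx ++ c)))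
  ...   | f , refl = anyUpTo⁺ _ (+-monoʳ-≤ (length rest) (+-cancelˡ-≤ (length lx) f d i≤)) (trans (φ-↭ perm) φi)
    where
    perm : v ∷ w ∷ take (length rest + f) (rest ++ c) ↭ take (length lx + f) (lx ++ c)
    perm rewrite take-+++ f rest c | take-+++ f lx c = ++⁺ʳ (take f c) (↭-sym lx↭)

  upper⁻-length : ∀ {j π} → upper⁻ j π ≡ true → r ≤ suc j
  upper⁻-length {j} {π} up = ≤-trans (r≤ _ (∧-trueˡ up)) (length-take≤ (suc j) π)

  three⇒good-++ : ∀ {p q s j} (l c : List A) → length l ≡ r → p < q → q < s → s < r → j < length (l ++ c) →
    upper⁻ j (toFront p (l ++ c)) ≡ true → upper⁻ j (toFront q (l ++ c)) ≡ true → upper⁻ j (toFront s (l ++ c)) ≡ true →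
    good (triple p q s (l ++ c)) ≡ true
  three⇒good-++ {p} {q} {s} {j} l c refl p<q q<s s<r j<π upˣ upʸ upᶻ with extract l p<q q<s s<r
  ... | record { x = x ; y = y ; z = z ; rest = rest ; lx = lx ; ly = ly ; lz = lz ; triple≡ = triple≡
               ; frontˣ = fx ; frontʸ = fy ; frontᶻ = fz ; lx↭ = lx↭ ; ly↭ = ly↭ ; lz↭ = lz↭ }
    = trans (cong good triple-l++c) (anyUpTo⁺ _ k≤L (∧-true φxyz (∧-true
        (pair-survives rest lx c lx↭ |x∷lx| (level {lx} |x∷lx|) (subst (λ m → anyUpTo j (λ i → φ (take i (drop 1 m))) ≡ true) fx++ (∧-trueʳ upˣ)))
      (∧-true
        (pair-survives rest ly c ly↭ |y∷ly| (level {ly} |y∷ly|) (subst (λ m → anyUpTo j (λ i → φ (take i (drop 1 m))) ≡ true) fy++ (∧-trueʳ upʸ)))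
        (pair-survives rest lz c lz↭ |z∷lz| (level {lz} |z∷lz|) (subst (λ m → anyUpTo j (λ i → φ (take i (drop 1 m))) ≡ true) fz++ (∧-trueʳ upᶻ)))))))
    where
    q<r = <-trans q<s s<r
    p<r = <-trans p<q q<r
    d : ℕ
    -- The number of elements that the upper member has beyond the bottom `l`.
    d = suc j ∸ length l
    l+d : length l + d ≡ suc j
    l+d = m+[n∸m]≡n (upper⁻-length {π = toFront p (l ++ c)} upˣ)
    -- What remains of the upper member after its three extracted elements, `j` - 2 in number.
    k = length rest + d
    front++ : ∀ {k a m} → k < length l → toFront k l ≡ a ∷ m → toFront k (l ++ c) ≡ a ∷ m ++ c
    front++ {k} k<l eq = trans (toFront-++ˡ k l c k<l) (cong (_++ c) eq)
    fx++ = front++ p<r fx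
    fy++ = front++ q<r fy
    fz++ = front++ s<r fz
    |toFront| : ∀ {k a m} → toFront k l ≡ a ∷ m → suc (length m) ≡ length l
    |toFront| {k} eq = trans (cong length (sym eq)) (↭-length (toFront-↭ k l))
    |x∷lx| = |toFront| {p} fx
    |y∷ly| = |toFront| {q} fy
    |z∷lz| = |toFront| {s} fz
    level : ∀ {m : List A} → suc (length m) ≡ length l → length m + d ≡ j
    level {m} eq = suc-injective (trans (cong (_+ d) eq) l+d)
    triple-l : toFront (2 + p) (toFront (1 + q) (toFront s l) ++ c) ≡ triple p q s l ++ c
    triple-l = toFront-++ˡ (2 + p) (toFront (1 + q) (toFront s l)) c (≤-<-trans (s≤s p<q) (≤-<-trans q<s
      (≤-trans s<r (≤-reflexive (sym (trans (↭-length (toFront-↭ (1 + q) (toFront s l))) (↭-length (toFront-↭ s l))))))))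
    triple-l++c : triple p q s (l ++ c) ≡ x ∷ y ∷ z ∷ rest ++ c
    triple-l++c = begin
      triple p q s (l ++ c)                                 ≡⟨ cong (toFront (2 + p) ∘ toFront (1 + q)) (toFront-++ˡ s l c s<r) ⟩
      toFront (2 + p) (toFront (1 + q) (toFront s l ++ c))  ≡⟨ cong (toFront (2 + p)) (toFront-++ˡ (1 + q) (toFront s l) c
                                                                (≤-<-trans q<s (≤-trans s<r (≤-reflexive (sym (↭-length (toFront-↭ s l))))))) ⟩
      toFront (2 + p) (toFront (1 + q) (toFront s l) ++ c)  ≡⟨ triple-l ⟩
      triple p q s l ++ c                                   ≡⟨ cong (_++ c) triple≡ ⟩
      x ∷ y ∷ z ∷ rest ++ c                                 ∎
      where open ≡-Reasoning
    taken : take (suc j) (toFront p (l ++ c)) ≡ x ∷ lx ++ take d c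
    taken = trans (cong (take (suc j)) fx++) (cong (x ∷_)
      (trans (cong (λ e → take e (lx ++ c)) (sym (level {lx} |x∷lx|))) (take-+++ d lx c)))
    perm : x ∷ y ∷ z ∷ take k (rest ++ c) ↭ take (suc j) (toFront p (l ++ c))
    perm = subst₂ _↭_ (cong (λ m → x ∷ y ∷ z ∷ m) (sym (take-+++ d rest c))) (sym taken)
      (prep x (++⁺ʳ (take d c) (↭-sym lx↭)))
    φxyz : φ (x ∷ y ∷ z ∷ take k (rest ++ c)) ≡ true
    φxyz = trans (φ-↭ perm) (∧-trueˡ upˣ)
    2+k≡j : 2 + k ≡ j
    2+k≡j = trans (cong (_+ d) (sym (↭-length lx↭))) (level {lx} |x∷lx|)
    k≤L : k ≤ L
    k≤L = begin
      k                                             ≤⟨ m≤n+m k 3 ⟩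
      3 + k                                         ≡⟨ cong suc 2+k≡j ⟩
      suc j                                         ≡⟨ m≤n⇒m⊓n≡m j<π ⟨
      suc j ⊓ length (l ++ c)              ≡⟨ cong (suc j ⊓_) (↭-length (toFront-↭ p (l ++ c))) ⟨
      suc j ⊓ length (toFront p (l ++ c))  ≡⟨ length-take (suc j) (toFront p (l ++ c)) ⟨
      length (take (suc j) (toFront p (l ++ c)))    ≤⟨ ≤L _ (∧-trueˡ upˣ) ⟩
      L                                             ∎
      where open ≤-Reasoning

  three⇒good : ∀ {p q s j} (π : List A) → r ≤ length π → p < q → q < s → s < r → j < length π →
    upper⁻ j (toFront p π) ≡ true → upper⁻ j (toFront q π) ≡ true → upper⁻ j (toFront s π) ≡ true →
    good (triple p q s π) ≡ true
  three⇒good π r≤π with take r π | drop r π | take++drop≡id r π | trans (length-take r π) (m≤n⇒m⊓n≡m r≤π)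
  ... | l | c | refl | |l| = three⇒good-++ l c |l|

  -- All triples of positions below `r` are counted, in any order, so that the average over
  -- arrangements is exactly the cube of `r` times that of `good`.
  goodTriples : List A → ℕ
  goodTriples π = ∑ (upTo r) (λ s → ∑ (upTo r) (λ q → ∑ (upTo r) (λ p → χ (good (triple p q s π)))))

  -- If at most two positions succeed, the 2 covers them. Three successes yield a good triple by
  -- `three⇒good`, and then `r * goodTriples π` covers all `r` positions. Any success forces `φ` on
  -- the prefix of length `suc j`, since the moved entry lies inside that prefix.
  upper⁻≤ : ∀ π j → r ≤ length π → j < length π →
    ∑ (upTo r) (λ p → χ (upper⁻ j (toFront p π))) ≤ χ (φ (take (suc j) π)) * (2 + r * goodTriples π)
  upper⁻≤ π j r≤π j<π with φ (take (suc j) π) in φj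
  ... | false = ≤-trans (∑-bound (upTo r) {c = 0} (λ {p} p∈ → χ-mono {b = false} (λ up → trans (sym φj)
                  (trans (sym (φ-↭ (take-toFront-↭ π (≤-pred (<-≤-trans (∈-upTo⁻ p∈) (upper⁻-length {π = toFront p π} up))) j<π)))
                         (∧-trueˡ up)))))
                (≤-reflexive (*-zeroʳ (length (upTo r))))
  ... | true with 3 ≤? ∑ (upTo r) (λ p → χ (upper⁻ j (toFront p π)))
  ...   | no  few  = ≤-trans (≤-pred (≰⇒> few)) (≤-trans (m≤m+n 2 _) (m≤m+n _ 0))
  ...   | yes many with choose 3 r _ many
  ...     | ι , ok , mono = begin
    ∑ (upTo r) (λ p → χ (upper⁻ j (toFront p π)))  ≤⟨ ∑-bound (upTo r) (λ _ → χ≤1 _) ⟩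
    length (upTo r) * 1                            ≡⟨ cong (_* 1) (length-upTo r) ⟩
    r * 1                                          ≤⟨ *-monoʳ-≤ r one≤ ⟩
    r * goodTriples π                              ≤⟨ m≤n+m _ 2 ⟩
    2 + r * goodTriples π                          ≤⟨ m≤m+n _ 0 ⟩
    2 + r * goodTriples π + 0                      ∎
    where
    open ≤-Reasoning
    lt : ∀ {i} → i < 3 → ι i ∈ upTo r
    lt i<3 = ∈-upTo⁺ (proj₁ (ok i<3))
    up : ∀ {i} → i < 3 → upper⁻ j (toFront (ι i) π) ≡ true
    up i<3 = proj₂ (ok i<3)
    1<3 = s≤s (s≤s z≤n)
    2<3 = s≤s (s≤s (s≤s z≤n))
    one≤ : 1 ≤ goodTriples π
    one≤ = begin
      1                                              ≡⟨ cong χ (three⇒good π r≤π (mono (s≤s z≤n) 1<3) (mono (s≤s (s≤s z≤n)) 2<3)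
                                                          (proj₁ (ok 2<3)) j<π (up (s≤s z≤n)) (up 1<3) (up 2<3)) ⟨
      χ (good (triple (ι 0) (ι 1) (ι 2) π))          ≤⟨ term≤∑ (λ p → χ (good (triple p (ι 1) (ι 2) π))) (lt (s≤s z≤n)) ⟩
      ∑ (upTo r) (λ p → χ (good (triple p (ι 1) (ι 2) π)))
                                                     ≤⟨ term≤∑ (λ q → ∑ (upTo r) (λ p → χ (good (triple p q (ι 2) π)))) (lt 1<3) ⟩
      ∑ (upTo r) (λ q → ∑ (upTo r) (λ p → χ (good (triple p q (ι 2) π))))
                                                     ≤⟨ term≤∑ (λ s → ∑ (upTo r) (λ q → ∑ (upTo r) (λ p → χ (good (triple p q s π))))) (lt 2<3) ⟩
      goodTriples π                                  ∎

  goodTriples-average : ∀ n (xs : List A) →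
    ∑ (arrangements n xs) goodTriples ≡ r * (r * (r * ∑ (arrangements n xs) (χ ∘ good)))
  goodTriples-average n xs =
    trans (∑-swap P (upTo r) _) (∑-upTo-const r (λ s → trans (∑-swap P (upTo r) _) (∑-upTo-const r (λ q → trans (∑-swap P (upTo r) _) (∑-upTo-const r (λ p →
      trans (∑-toFront s n xs (λ π → χ (good (toFront (2 + p) (toFront (1 + q) π)))))
      (trans (∑-toFront (1 + q) n xs (λ π → χ (good (toFront (2 + p) π))))
             (∑-toFront (2 + p) n xs (χ ∘ good)))))))))
    where
    P = arrangements n xs

  module _ (n : ℕ) (xs : List A) (|xs| : length xs ≡ n) where

    private
      P = arrangements n xs
      Y S : ℕ
      Y = ∑ P (λ π → ∑ (upTo n) (λ j → χ (upper j π)))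
      S = ∑ P (χ ∘ good)

      |π| : ∀ {π} → π ∈ P → length π ≡ n
      |π| π∈ = trans (↭-length (arrangements-↭ n |xs| π∈)) |xs|

    levels≤upper : ∑ P (λ π → ∑ (upTo (suc n)) (λ j → χ (φ (take j π)))) ≤ n ! + Y
    levels≤upper = begin
      ∑ P (λ π → ∑ (upTo (suc n)) (λ j → χ (φ (take j π))))    ≤⟨ ∑-mono P (λ {π} _ → count≤1+successors n (λ j → φ (take j π))) ⟩
      ∑ P (λ π → 1 + ∑ (upTo n) (λ j → χ (upper j π)))         ≡⟨ ∑-+ P (λ _ → 1) _ ⟩
      ∑ P (λ _ → 1) + Y                                        ≡⟨ cong (_+ Y) (trans (∑-const P 1) (trans (*-identityʳ _) (length-arrangements n xs |xs|))) ⟩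
      n ! + Y                                                  ∎
      where open ≤-Reasoning

    ∑-upper : ∀ k j → j < n → ∑ P (λ π → χ (upper⁻ j (toFront k π))) ≡ ∑ P (λ π → χ (upper j π))
    ∑-upper k j j<n = begin
      ∑ P (λ π → χ (upper⁻ j (toFront k π)))  ≡⟨ ∑-toFront k n xs (χ ∘ upper⁻ j) ⟩
      ∑ P (χ ∘ upper⁻ j)                      ≡⟨ ∑-toFront j n xs (χ ∘ upper⁻ j) ⟨
      ∑ P (λ π → χ (upper⁻ j (toFront j π)))  ≡⟨ ∑-cong P (λ {π} π∈ → cong χ (upper⁻-toFront j π (subst (j <_) (sym (|π| π∈)) j<n))) ⟩
      ∑ P (λ π → χ (upper j π))               ∎
      where open ≡-Reasoning

    r*upper : r * Y ≡ ∑ P (λ π → ∑ (upTo n) (λ j → ∑ (upTo r) (λ p → χ (upper⁻ j (toFront p π)))))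
    r*upper = sym (begin
      ∑ P (λ π → ∑ (upTo n) (λ j → ∑ (upTo r) (λ p → χ (upper⁻ j (toFront p π)))))  ≡⟨ ∑-swap P (upTo n) _ ⟩
      ∑ (upTo n) (λ j → ∑ P (λ π → ∑ (upTo r) (λ p → χ (upper⁻ j (toFront p π)))))  ≡⟨ ∑-cong (upTo n) (λ j∈ →
        trans (∑-swap P (upTo r) _) (trans (∑-cong (upTo r) (λ {p} _ → ∑-upper p _ (∈-upTo⁻ j∈)))
          (trans (∑-const (upTo r) _) (cong (_* _) (length-upTo r))))) ⟩
      ∑ (upTo n) (λ j → r * ∑ P (λ π → χ (upper j π)))                              ≡⟨ ∑-* (upTo n) r _ ⟩
      r * ∑ (upTo n) (λ j → ∑ P (λ π → χ (upper j π)))                              ≡⟨ cong (r *_) (∑-swap P (upTo n) _) ⟨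
      r * Y                                                                         ∎)
      where open ≡-Reasoning

    module _ (H : ℕ) (r≤n : r ≤ n) (levels≤H : ∀ π → π ↭ xs → levels π ≤ H) where

      r*upper≤ : r * Y ≤ H * (2 * n ! + r * (r * (r * (r * S))))
      r*upper≤ = begin
        r * Y                                                       ≡⟨ r*upper ⟩
        ∑ P (λ π → ∑ (upTo n) (λ j → ∑ (upTo r) (λ p → χ (upper⁻ j (toFront p π)))))
          ≤⟨ ∑-mono P (λ π∈ → pointwise _ (|π| π∈) (arrangements-↭ n |xs| π∈)) ⟩
        ∑ P (λ π → H * (2 + r * goodTriples π))                     ≡⟨ ∑-* P H _ ⟩
        H * ∑ P (λ π → 2 + r * goodTriples π)                       ≡⟨ cong (H *_) (∑-+ P (λ _ → 2) _) ⟩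
        H * (∑ P (λ _ → 2) + ∑ P (λ π → r * goodTriples π))         ≡⟨ cong (H *_) (cong₂ _+_
          (trans (∑-const P 2) (trans (cong (_* 2) (length-arrangements n xs |xs|)) (*-comm (n !) 2)))
          (trans (∑-* P r _) (cong (r *_) (goodTriples-average n xs)))) ⟩
        H * (2 * n ! + r * (r * (r * (r * S))))                     ∎
        where
        open ≤-Reasoning
        pointwise : ∀ π → length π ≡ n → π ↭ xs →
          ∑ (upTo n) (λ j → ∑ (upTo r) (λ p → χ (upper⁻ j (toFront p π)))) ≤ H * (2 + r * goodTriples π)
        pointwise π refl π↭ = begin
          ∑ (upTo n) (λ j → ∑ (upTo r) (λ p → χ (upper⁻ j (toFront p π))))          ≤⟨ ∑-mono (upTo n) (λ j∈ → upper⁻≤ π _ r≤n (∈-upTo⁻ j∈)) ⟩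
          ∑ (upTo n) (λ j → χ (φ (take (suc j) π)) * (2 + r * goodTriples π))       ≡⟨ ∑-cong (upTo n) (λ {j} _ → *-comm (χ (φ (take (suc j) π))) (2 + r * goodTriples π)) ⟩
          ∑ (upTo n) (λ j → (2 + r * goodTriples π) * χ (φ (take (suc j) π)))       ≡⟨ ∑-* (upTo n) (2 + r * goodTriples π) _ ⟩
          (2 + r * goodTriples π) * levels π                                        ≡⟨ *-comm (2 + r * goodTriples π) (levels π) ⟩
          levels π * (2 + r * goodTriples π)                                        ≤⟨ *-monoˡ-≤ (2 + r * goodTriples π) (levels≤H π π↭) ⟩
          H * (2 + r * goodTriples π)                                               ∎

      -- The excess gives `n ! ≤ E * Y`. The two positions conceded in `upper⁻≤` cost 2·E·H·`n !`,
      -- which is half of r·`n !` because r = 4·E·H; the other half must come from good triples. The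
      -- density obtained depends on `r` only.
      good-dense : ∀ E → 1 ≤ E * H → r ≡ 4 * (E * H) →
        suc E * n ! ≤ E * ∑ P (λ π → ∑ (upTo (suc n)) (λ j → χ (φ (take j π)))) →
        n ! ≤ r * (r * (r * r)) * S
      good-dense E 1≤c r≡ big = ≤-trans (m≤n+m (n !) (n !)) (≤-trans (≤-reflexive (cong (n ! +_) (sym (+-identityʳ (n !)))))
        (*-cancelˡ-≤ c {{>-nonZero 1≤c}} (+-cancelˡ-≤ (c * (2 * n !)) _ _ (begin
        c * (2 * n !) + c * (2 * n !)                            ≡⟨ arith₁ c (n !) ⟩
        4 * c * n !                                              ≡⟨ cong (_* n !) r≡ ⟨
        r * n !                                                  ≤⟨ *-monoʳ-≤ r n!≤ ⟩
        r * (E * Y)                                              ≡⟨ arith₂ r E Y ⟩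
        E * (r * Y)                                              ≤⟨ *-monoʳ-≤ E r*upper≤ ⟩
        E * (H * (2 * n ! + r * (r * (r * (r * S)))))            ≡⟨ arith₃ E H (n !) r S ⟩
        c * (2 * n !) + c * (r * (r * (r * r)) * S)              ∎))))
        where
        open ≤-Reasoning
        c = E * H
        arith₁ : ∀ c N → c * (2 * N) + c * (2 * N) ≡ 4 * c * N
        arith₁ = solve-∀
        arith₂ : ∀ r E Y → r * (E * Y) ≡ E * (r * Y)
        arith₂ = solve-∀
        arith₃ : ∀ E H N r S → E * (H * (2 * N + r * (r * (r * (r * S))))) ≡ E * H * (2 * N) + E * H * (r * (r * (r * r)) * S)
        arith₃ = solve-∀
        n!≤ : n ! ≤ E * Y
        n!≤ = +-cancelʳ-≤ (E * n !) _ _ (begin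
          n ! + E * n !        ≤⟨ big ⟩
          E * _                ≤⟨ *-monoʳ-≤ E levels≤upper ⟩
          E * (n ! + Y)        ≡⟨ trans (*-distribˡ-+ E (n !) Y) (+-comm (E * n !) _) ⟩
          E * Y + E * n !      ∎)

-- Complete tripartite subgraphs of dense 3-graphs

-- Scale the weights by 2·D, so that the total is at least 2·a·N. Light values, those with 2·D·w
-- below a, contribute at most a per index, together N·a. If every heavy value occurred fewer than
-- `m` times, the heavy ones would add at most `length sigs * (m * (2 * D)) * a`, which is less than
-- N·a.
popular : {S : Set} (_≟_ : (u v : S) → Dec (u ≡ v)) (sigs : List S) (w : S → ℕ) (D m a N : ℕ) (h : ℕ → S) →
  (∀ {v} → v ∈ sigs → w v ≤ a) → (∀ {i} → i < N → h i ∈ sigs) → 1 ≤ a →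
  length sigs * (m * (2 * D)) < N → a * N ≤ D * ∑ (upTo N) (w ∘ h) →
  ∃[ v ] a ≤ 2 * D * w v × m ≤ ∑ (upTo N) (λ i → χ (does (h i ≟ v)))
popular {S} _≟_ sigs w D m a N h w≤a h∈ 1≤a large dense
  with Any.any? (λ v → (a ≤? 2 * D * w v) ×-dec (m ≤? ∑ (upTo N) (λ i → χ (does (h i ≟ v))))) sigs
... | yes found = let v , _ , heavy , many = find found in v , heavy , many
... | no  none  = ⊥-elim (<⇒≱ large (*-cancelʳ-≤ _ _ a {{>-nonZero 1≤a}} (+-cancelˡ-≤ (N * a) _ _ (begin
  N * a + N * a                                            ≡⟨ arith₁ N a ⟩
  2 * (a * N)                                              ≤⟨ *-monoʳ-≤ 2 dense ⟩
  2 * (D * ∑ (upTo N) (w ∘ h))                             ≡⟨ trans (sym (*-assoc 2 D _)) (sym (∑-* (upTo N) (2 * D) (w ∘ h))) ⟩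
  ∑ (upTo N) (λ i → 2 * D * w (h i))                       ≤⟨ ∑-mono (upTo N) (λ i∈ → split (h∈ (∈-upTo⁻ i∈))) ⟩
  ∑ (upTo N) (λ i → a + ∑ sigs (λ v → χ (does (h i ≟ v)) * cost v))
    ≡⟨ trans (∑-+ (upTo N) (λ _ → a) _) (cong₂ _+_ (trans (∑-const (upTo N) a) (cong (_* a) (length-upTo N))) (∑-swap (upTo N) sigs _)) ⟩
  N * a + ∑ sigs (λ v → ∑ (upTo N) (λ i → χ (does (h i ≟ v)) * cost v))
    ≤⟨ +-monoʳ-≤ (N * a) (∑-bound sigs rare) ⟩
  N * a + length sigs * (m * (2 * D * a))                  ≡⟨ cong (N * a +_) (arith₂ (length sigs) m D a) ⟩
  N * a + length sigs * (m * (2 * D)) * a                  ∎))))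
  where
  open ≤-Reasoning
  heavy? : ∀ v → Dec (a ≤ 2 * D * w v)
  heavy? v = a ≤? 2 * D * w v
  cost : S → ℕ
  cost v = χ (does (heavy? v)) * (2 * D * a)
  arith₁ : ∀ N a → N * a + N * a ≡ 2 * (a * N)
  arith₁ = solve-∀
  arith₂ : ∀ l m D a → l * (m * (2 * D * a)) ≡ l * (m * (2 * D)) * a
  arith₂ = solve-∀
  self : ∀ u → a ≤ 2 * D * w u → 2 * D * a ≡ χ (does (u ≟ u)) * cost u
  self u heavy rewrite dec-true (u ≟ u) refl | dec-true (heavy? u) heavy = sym (trans (*-identityˡ _) (*-identityˡ _))
  split : ∀ {u} → u ∈ sigs → 2 * D * w u ≤ a + ∑ sigs (λ v → χ (does (u ≟ v)) * cost v)
  split {u} u∈ with heavy? u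
  ... | no light  = ≤-trans (<⇒≤ (≰⇒> light)) (m≤m+n a _)
  ... | yes heavy = begin
    2 * D * w u                                      ≤⟨ *-monoʳ-≤ (2 * D) (w≤a u∈) ⟩
    2 * D * a                                        ≡⟨ self u heavy ⟩
    χ (does (u ≟ u)) * cost u                        ≤⟨ term≤∑ (λ v → χ (does (u ≟ v)) * cost v) u∈ ⟩
    ∑ sigs (λ v → χ (does (u ≟ v)) * cost v)         ≤⟨ m≤n+m _ a ⟩
    a + ∑ sigs (λ v → χ (does (u ≟ v)) * cost v)     ∎
  rare : ∀ {v} → v ∈ sigs → ∑ (upTo N) (λ i → χ (does (h i ≟ v)) * cost v) ≤ m * (2 * D * a)
  rare {v} v∈ with m ≤? ∑ (upTo N) (λ i → χ (does (h i ≟ v)))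
  ... | yes many rewrite dec-false (heavy? v) (λ heavy → none (lose v∈ (heavy , many))) =
    ≤-trans (∑-mono (upTo N) (λ {i} _ → ≤-reflexive (*-zeroʳ (χ (does (h i ≟ v))))))
    (≤-trans (≤-reflexive (trans (∑-const (upTo N) 0) (*-zeroʳ (length (upTo N))))) z≤n)
  ... | no few = begin
    ∑ (upTo N) (λ i → χ (does (h i ≟ v)) * cost v)   ≡⟨ ∑-cong (upTo N) (λ {i} _ → *-comm (χ (does (h i ≟ v))) (cost v)) ⟩
    ∑ (upTo N) (λ i → cost v * χ (does (h i ≟ v)))   ≡⟨ trans (∑-* (upTo N) (cost v) _) (*-comm (cost v) _) ⟩
    ∑ (upTo N) (λ i → χ (does (h i ≟ v))) * cost v   ≤⟨ *-mono-≤ (<⇒≤ (≰⇒> few)) (≤-trans (*-monoˡ-≤ (2 * D * a) (χ≤1 (does (heavy? v)))) (≤-reflexive (*-identityˡ _))) ⟩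
    m * (2 * D * a)                                  ∎

Increasing : ℕ → ℕ → (ℕ → ℕ) → Set
Increasing m N ι = (∀ {i} → i < m → ι i < N) × (∀ {i j} → i < j → j < m → ι i < ι j)

uniform : {S : Set} (_≟_ : (u v : S) → Dec (u ≡ v)) (sigs : List S) (w : S → ℕ) (D m a N : ℕ) (h : ℕ → S) →
  (∀ {v} → v ∈ sigs → w v ≤ a) → (∀ {i} → i < N → h i ∈ sigs) → 1 ≤ a →
  length sigs * (suc m * (2 * D)) < N → a * N ≤ D * ∑ (upTo N) (w ∘ h) →
  Σ[ ι ∈ (ℕ → ℕ) ] Increasing (suc m) N ι × (∀ {i} → i < suc m → h (ι i) ≡ h (ι 0)) × a ≤ 2 * D * w (h (ι 0))
uniform _≟_ sigs w D m a N h w≤a h∈ 1≤a large dense with popular _≟_ sigs w D (suc m) a N h w≤a h∈ 1≤a large dense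
... | v , heavy , many with choose (suc m) N (λ i → does (h i ≟ v)) many
...   | ι , ok , mono = ι , (proj₁ ∘ ok , mono) , (λ i< → trans (eq i<) (sym (eq (s≤s z≤n)))) ,
                        subst (λ u → a ≤ 2 * D * w u) (sym (eq (s≤s z≤n))) heavy
  where
  eq : ∀ {i} → i < suc m → h (ι i) ≡ v
  eq {i} i< with h (ι i) ≟ v | proj₂ (ok i<)
  ... | yes p | _ = p

tuples : ℕ → List B → List (List B)
tuples zero    L = [] ∷ []
tuples (suc n) L = concatMap (λ b → map (b ∷_) (tuples n L)) L

tuples⁺ : ∀ n {L : List B} (f : ℕ → B) → (∀ {i} → i < n → f i ∈ L) → applyUpTo f n ∈ tuples n L
tuples⁺ zero    f f∈ = here refl
tuples⁺ (suc n) f f∈ = ∈-concatMap⁺ _ (lose (f∈ (s≤s z≤n)) (∈-map⁺ (f 0 ∷_) (tuples⁺ n (f ∘ suc) (f∈ ∘ s≤s))))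

∑-tuples≤ : ∀ n {L : List B} {w : B → ℕ} {c} {v} → (∀ {b} → b ∈ L → w b ≤ c) → v ∈ tuples n L → ∑ v w ≤ n * c
∑-tuples≤ zero    w≤c (here refl) = z≤n
∑-tuples≤ (suc n) {L} w≤c v∈ with find (∈-concatMap⁻ (λ b → map (b ∷_) (tuples n L)) {xs = L} v∈)
... | b , b∈ , v∈′ with ∈-map⁻ (b ∷_) v∈′
...   | u , u∈ , refl = +-mono-≤ (w≤c b∈) (∑-tuples≤ n w≤c u∈)

∑-applyUpTo : ∀ n (f : ℕ → B) (w : B → ℕ) → ∑ (applyUpTo f n) w ≡ ∑ (upTo n) (w ∘ f)
∑-applyUpTo n f w = trans (cong (λ l → ∑ l w) (sym (map-upTo f n))) (∑-map (upTo n) f w)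

applyUpTo-injective : ∀ n {f g : ℕ → B} → applyUpTo f n ≡ applyUpTo g n → ∀ {i} → i < n → f i ≡ g i
applyUpTo-injective (suc n) eq {zero}  _         = ∷-injectiveˡ eq
applyUpTo-injective (suc n) eq {suc i} (s≤s i<n) = applyUpTo-injective n (∷-injectiveʳ eq) i<n

bits : List Bool
bits = true ∷ false ∷ []

∈-bits : ∀ b → b ∈ bits
∈-bits true  = here refl
∈-bits false = there (here refl)

-- A 3-partite 3-graph with edge density at least 1/D contains a complete tripartite one with parts
-- of size `m`: a qualitative case of Erdős's theorem on complete multipartite hypergraphs.
ForcesTripartite : (D m M₁ M₂ M₃ : ℕ) → Set
ForcesTripartite D m M₁ M₂ M₃ = (g : ℕ → ℕ → ℕ → Bool) →
  M₁ * M₂ * M₃ ≤ D * ∑ (upTo M₃) (λ z → ∑ (upTo M₂) (λ y → ∑ (upTo M₁) (λ x → χ (g x y z)))) →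
  Σ[ ξ ∈ (ℕ → ℕ) ] Σ[ η ∈ (ℕ → ℕ) ] Σ[ ζ ∈ (ℕ → ℕ) ]
    Increasing m M₁ ξ × Increasing m M₂ η × Increasing m M₃ ζ ×
    (∀ {i j k} → i < m → j < m → k < m → g (ξ i) (η j) (ζ k) ≡ true)

-- By pigeonhole many z have the same dense slice, and then many y have the same dense row in that slice.
complete-tripartite : ∀ D m M₁ M₂ M₃ → 1 ≤ D → 1 ≤ M₁ → 2 * (2 * D) * suc m ≤ M₁ →
  length (tuples M₁ bits) * (suc m * (2 * (2 * D))) < M₂ →
  length (tuples M₂ (tuples M₁ bits)) * (suc m * (2 * D)) < M₃ →
  ForcesTripartite D (suc m) M₁ M₂ M₃
complete-tripartite D m M₁ M₂ M₃ 1≤D 1≤M₁ large₁ large₂ large₃ g dense = result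
  where
  row : ℕ → ℕ → List Bool
  row z y = applyUpTo (λ x → g x y z) M₁
  slice : ℕ → List (List Bool)
  slice z = applyUpTo (row z) M₂
  rowWeight : List Bool → ℕ
  rowWeight v = ∑ v χ
  row∈ : ∀ z y → row z y ∈ tuples M₁ bits
  row∈ z y = tuples⁺ M₁ _ (λ _ → ∈-bits _)
  rowWeight≤ : ∀ {v} → v ∈ tuples M₁ bits → rowWeight v ≤ M₁
  rowWeight≤ v∈ = ≤-trans (∑-tuples≤ M₁ (λ {b} _ → χ≤1 b) v∈) (≤-reflexive (*-identityʳ M₁))
  rowWeight≡ : ∀ z y → rowWeight (row z y) ≡ ∑ (upTo M₁) (λ x → χ (g x y z))
  rowWeight≡ z y = ∑-applyUpTo M₁ _ χ
  sliceWeight≡ : ∀ z → ∑ (slice z) rowWeight ≡ ∑ (upTo M₂) (rowWeight ∘ row z)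
  sliceWeight≡ z = ∑-applyUpTo M₂ (row z) rowWeight
  inner : Σ[ ζ ∈ (ℕ → ℕ) ] Increasing (suc m) M₃ ζ × (∀ {i} → i < suc m → slice (ζ i) ≡ slice (ζ 0)) ×
          M₂ * M₁ ≤ 2 * D * ∑ (slice (ζ 0)) rowWeight
  inner = uniform (≡-dec (≡-dec _≟ᵇ_)) (tuples M₂ (tuples M₁ bits)) (λ v → ∑ v rowWeight) D m (M₂ * M₁) M₃ slice
    (∑-tuples≤ M₂ rowWeight≤) (λ {z} _ → tuples⁺ M₂ (row z) (λ {y} _ → row∈ z y))
    (*-mono-≤ {1} {M₂} (≤-trans (s≤s z≤n) large₂) 1≤M₁) large₃
    (subst₂ _≤_ (cong (_* M₃) (*-comm M₁ M₂))
      (cong (D *_) (∑-cong (upTo M₃) (λ {z} _ → sym (trans (sliceWeight≡ z) (∑-cong (upTo M₂) (λ {y} _ → rowWeight≡ z y))))))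
      dense)
  result : Σ[ ξ ∈ (ℕ → ℕ) ] Σ[ η ∈ (ℕ → ℕ) ] Σ[ ζ ∈ (ℕ → ℕ) ]
    Increasing (suc m) M₁ ξ × Increasing (suc m) M₂ η × Increasing (suc m) M₃ ζ ×
    (∀ {i j k} → i < suc m → j < suc m → k < suc m → g (ξ i) (η j) (ζ k) ≡ true)
  result with inner
  ... | ζ , incζ , sameζ , denseζ
    with uniform (≡-dec _≟ᵇ_) (tuples M₁ bits) rowWeight (2 * D) m M₁ M₂ (row (ζ 0))
           rowWeight≤ (λ {y} _ → row∈ (ζ 0) y) 1≤M₁ large₂
           (subst₂ _≤_ (*-comm M₂ M₁) (cong (2 * D *_) (sliceWeight≡ (ζ 0))) denseζ)
  ... | η , incη , sameη , denseη
    with choose (suc m) M₁ (λ x → g x (η 0) (ζ 0))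
           (*-cancelˡ-≤ (2 * (2 * D)) {{>-nonZero (*-mono-≤ {1} {2} (s≤s z≤n) (*-mono-≤ {1} {2} (s≤s z≤n) 1≤D))}}
             (≤-trans large₁ (subst (λ s → M₁ ≤ 2 * (2 * D) * s) (rowWeight≡ (ζ 0) (η 0)) denseη)))
  ... | ξ , ok , monoξ = ξ , η , ζ , (proj₁ ∘ ok , monoξ) , incη , incζ ,
    λ {i} {j} {k} i< j< k< →
      trans (applyUpTo-injective M₁ (applyUpTo-injective M₂ (sameζ k<) (proj₁ incη j<)) (proj₁ (ok i<)))
      (trans (applyUpTo-injective M₁ (sameη j<) (proj₁ (ok i<))) (proj₂ (ok i<)))

-- Each of the two pigeonhole steps halves the guaranteed density, so the final row still has
-- M₁/(4·D) entries `true`, and `M₁` makes this `suc m`. `M₂` and `M₃` outnumber the possible rows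
-- and slices by the factors that `popular` asks for.
dense⇒tripartite : ∀ D m → 1 ≤ D → ∃[ M₁ ] ∃[ M₂ ] ∃[ M₃ ] ForcesTripartite D (suc m) M₁ M₂ M₃
dense⇒tripartite D m 1≤D = M₁ , M₂ , M₃ , complete-tripartite D m M₁ M₂ M₃ 1≤D 1≤M₁ ≤-refl ≤-refl ≤-refl
  where
  M₁ = 2 * (2 * D) * suc m
  M₂ = suc (length (tuples M₁ bits) * (suc m * (2 * (2 * D))))
  M₃ = suc (length (tuples M₂ (tuples M₁ bits)) * (suc m * (2 * D)))
  1≤M₁ : 1 ≤ M₁
  1≤M₁ = *-mono-≤ {1} {2 * (2 * D)} {1} {suc m} (*-mono-≤ {1} {2} (s≤s z≤n) (*-mono-≤ {1} {2} (s≤s z≤n) 1≤D)) (s≤s z≤n)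

-- Grids of good triples on one chain

at : {A : Set} → A → List A → ℕ → A
at d []      i       = d
at d (x ∷ l) zero    = x
at d (x ∷ l) (suc i) = at d l i

at-++ : {A : Set} (d : A) (u : List A) {x : A} {v : List A} → at d (u ++ x ∷ v) (length u) ≡ x
at-++ d []      = refl
at-++ d (y ∷ u) = at-++ d u

module _ {A : Set} (α : List A) (x : A) (β : List A) (y : A) (γ : List A) (z : A) (δ : List A) where

  private
    l = ((α ++ x ∷ β) ++ y ∷ γ) ++ z ∷ δ

  split₃-first : l ≡ α ++ x ∷ (β ++ y ∷ γ) ++ z ∷ δ
  split₃-first = trans (cong (_++ z ∷ δ) (++-assoc α (x ∷ β) (y ∷ γ))) (++-assoc α (x ∷ β ++ y ∷ γ) (z ∷ δ))

  at-first : ∀ d → at d l (length α) ≡ x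
  at-first d rewrite split₃-first = at-++ d α

  at-second : ∀ d → at d l (length (α ++ x ∷ β)) ≡ y
  at-second d rewrite ++-assoc (α ++ x ∷ β) (y ∷ γ) (z ∷ δ) = at-++ d (α ++ x ∷ β)

module Grids {A : Set} (φ : List A → Bool) (φ-↭ : ∀ {l m} → l ↭ m → φ l ≡ φ m)
  (r L : ℕ) (r≤ : ∀ l → φ l ≡ true → r ≤ length l) (≤L : ∀ l → φ l ≡ true → length l ≤ L) where

  open Averaging φ φ-↭ r L r≤ ≤L

  -- The levels of the three pairs are bounded by `level`, so each set with two of the elements lies
  -- inside the set with all three.
  record Witness (c : List A) (x y z : A) : Set where
    field
      level  : ℕ
      level≤ : level ≤ L
      φxyz   : φ (x ∷ y ∷ z ∷ take level c) ≡ true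
      φyz    : ∃[ i ] i ≤ level × φ (y ∷ z ∷ take i c) ≡ true
      φxz    : ∃[ i ] i ≤ level × φ (x ∷ z ∷ take i c) ≡ true
      φxy    : ∃[ i ] i ≤ level × φ (x ∷ y ∷ take i c) ≡ true

  good⇒Witness : ∀ {x y z} c → good (x ∷ y ∷ z ∷ c) ≡ true → Witness c x y z
  good⇒Witness {x} {y} {z} c g with anyUpTo⁻ L _ g
  ... | j , j≤L , gj = record
    { level = j ; level≤ = j≤L ; φxyz = ∧-trueˡ gj
    ; φyz = anyUpTo⁻ j _ (∧-trueˡ g₁)
    ; φxz = anyUpTo⁻ j _ (∧-trueˡ g₂)
    ; φxy = anyUpTo⁻ j _ (∧-trueʳ {anyUpTo j (λ i → φ (x ∷ z ∷ take i c))} g₂) }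
    where
    g₁ = ∧-trueʳ {φ (x ∷ y ∷ z ∷ take j c)} gj
    g₂ = ∧-trueʳ {anyUpTo j (λ i → φ (y ∷ z ∷ take i c))} g₁

  Witness-resp : ∀ {x y z} c c′ → (∀ {i} → i ≤ L → take i c ≡ take i c′) → Witness c x y z → Witness c′ x y z
  Witness-resp {x} {y} {z} c c′ c≈c′ w = record
    { level = level ; level≤ = level≤
    ; φxyz = subst (λ t → φ (x ∷ y ∷ z ∷ t) ≡ true) (c≈c′ level≤) φxyz
    ; φyz = move (λ t → y ∷ z ∷ t) φyz
    ; φxz = move (λ t → x ∷ z ∷ t) φxz
    ; φxy = move (λ t → x ∷ y ∷ t) φxy }
    where
    open Witness w
    move : (f : List A → List A) → ∃[ i ] i ≤ level × φ (f (take i c)) ≡ true → ∃[ i ] i ≤ level × φ (f (take i c′)) ≡ true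
    move f (i , i≤ , φi) = i , i≤ , subst (λ t → φ (f t) ≡ true) (c≈c′ (≤-trans i≤ level≤)) φi

  -- Prefixes of length up to `L` end before the three positions, so taking the entries out does not
  -- change them. All triples of a grid therefore use the same chain sets, those of `π` itself.
  good-triple⇒Witness : ∀ d π {p q s} → L ≤ p → p < q → q < s → s < length π → good (triple p q s π) ≡ true →
    Witness π (at d π p) (at d π q) (at d π s)
  good-triple⇒Witness d π {p} {q} {s} L≤p p<q q<s s<π g with split₃ π p<q q<s s<π
  ... | α , x , β , y , γ , z , δ , refl , refl , refl , refl
    rewrite triple-split α x β y γ z δ | at-++ d ((α ++ x ∷ β) ++ y ∷ γ) {z} {δ} | at-second α x β y γ z δ d | at-first α x β y γ z δ d
    = Witness-resp (α ++ β ++ γ ++ δ) π′ same (good⇒Witness (α ++ β ++ γ ++ δ) g)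
    where
    π′ = ((α ++ x ∷ β) ++ y ∷ γ) ++ z ∷ δ
    same : ∀ {i} → i ≤ L → take i (α ++ β ++ γ ++ δ) ≡ take i π′
    same i≤L rewrite split₃-first α x β y γ z δ =
      trans (take-++≤ α _ (≤-trans i≤L L≤p)) (sym (take-++≤ α _ (≤-trans i≤L L≤p)))

  -- Every choice of three positions contributes the same sum over arrangements, whatever `f`, `g`
  -- and `h` are; some arrangement reaches the mean.
  triple-dense : ∀ n (xs : List A) → length xs ≡ n → ∀ D (M₁ M₂ M₃ : ℕ) (f g h : ℕ → ℕ) →
    n ! ≤ D * ∑ (arrangements n xs) (χ ∘ good) →
    ∃[ π ] π ↭ xs × M₁ * M₂ * M₃ ≤
      D * ∑ (upTo M₃) (λ z → ∑ (upTo M₂) (λ y → ∑ (upTo M₁) (λ x → χ (good (triple (f x) (g y) (h z) π)))))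
  triple-dense n xs |xs| D M₁ M₂ M₃ f g h n!≤ =
    let π , π∈ , big = average P _ (subst (0 <_) (sym |P|) (n!>0 n)) dense
    in  π , arrangements-↭ n |xs| π∈ , big
    where
    open ≤-Reasoning
    P = arrangements n xs
    S = ∑ P (χ ∘ good)
    n!>0 : ∀ n → 0 < n !
    n!>0 zero    = s≤s z≤n
    n!>0 (suc n) = ≤-trans (n!>0 n) (m≤m+n (n !) (n * n !))
    |P| : length P ≡ n !
    |P| = length-arrangements n xs |xs|
    total : ∑ P (λ π → ∑ (upTo M₃) (λ z → ∑ (upTo M₂) (λ y → ∑ (upTo M₁) (λ x → χ (good (triple (f x) (g y) (h z) π))))))
            ≡ M₃ * (M₂ * (M₁ * S))
    total = trans (∑-swap P (upTo M₃) _) (∑-upTo-const M₃ (λ z → trans (∑-swap P (upTo M₂) _) (∑-upTo-const M₂ (λ y →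
      trans (∑-swap P (upTo M₁) _) (∑-upTo-const M₁ (λ x →
      trans (∑-toFront (h z) n xs (λ π → χ (good (toFront (2 + f x) (toFront (1 + g y) π)))))
      (trans (∑-toFront (1 + g y) n xs (λ π → χ (good (toFront (2 + f x) π))))
             (∑-toFront (2 + f x) n xs (χ ∘ good)))))))))
    arith : ∀ a b c D S → D * S * (a * b * c) ≡ D * (c * (b * (a * S)))
    arith = solve-∀
    dense = begin
      length P * (M₁ * M₂ * M₃)      ≡⟨ cong (_* (M₁ * M₂ * M₃)) |P| ⟩
      n ! * (M₁ * M₂ * M₃)           ≤⟨ *-monoˡ-≤ (M₁ * M₂ * M₃) n!≤ ⟩
      D * S * (M₁ * M₂ * M₃)         ≡⟨ arith M₁ M₂ M₃ D S ⟩
      D * (M₃ * (M₂ * (M₁ * S)))     ≡⟨ cong (D *_) total ⟨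
      D * ∑ P _                      ≡⟨ ∑-* P D _ ⟨
      ∑ P (λ π → D * ∑ (upTo M₃) (λ z → ∑ (upTo M₂) (λ y → ∑ (upTo M₁) (λ x → χ (good (triple (f x) (g y) (h z) π)))))) ∎

  record Grid (d : A) (m : ℕ) (π : List A) : Set where
    field
      X Y Z : ℕ → ℕ
      X-mono : ∀ {i j} → i < j → j < m → X i < X j
      Y-mono : ∀ {i j} → i < j → j < m → Y i < Y j
      Z-mono : ∀ {i j} → i < j → j < m → Z i < Z j
      L≤X : ∀ i → L ≤ X i
      X<Y : ∀ {i} j → i < m → X i < Y j
      Y<Z : ∀ {i} j → i < m → Y i < Z j
      Z<π : ∀ {i} → i < m → Z i < length π
      witness : ∀ {i j k} → i < m → j < m → k < m → Witness π (at d π (X i)) (at d π (Y j)) (at d π (Z k))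

  good-dense⇒Grid : ∀ d {D m M₁ M₂ M₃} n (xs : List A) → length xs ≡ n →
    ForcesTripartite D m M₁ M₂ M₃ → n ≡ L + M₁ + M₂ + M₃ → n ! ≤ D * ∑ (arrangements n xs) (χ ∘ good) →
    ∃[ π ] π ↭ xs × Grid d m π
  good-dense⇒Grid d {D} {m} {M₁} {M₂} {M₃} n xs |xs| forces n≡ n!≤
    with triple-dense n xs |xs| D (M₁) (M₂) (M₃)
           (L +_) (λ y → L + M₁ + y) (λ z → L + M₁ + M₂ + z) n!≤
  ... | π , π↭ , dense
    with forces (λ x y z → good (triple (L + x) (L + M₁ + y) (L + M₁ + M₂ + z) π)) dense
  ... | ξ , η , ζ , (ξ< , ξ-mono) , (η< , η-mono) , (ζ< , ζ-mono) , complete = π , π↭ , record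
    { X = λ i → L + ξ i ; Y = λ j → L + M₁ + η j ; Z = λ k → L + M₁ + M₂ + ζ k
    ; X-mono = λ i<j j<m → +-monoʳ-< L (ξ-mono i<j j<m)
    ; Y-mono = λ i<j j<m → +-monoʳ-< (L + M₁) (η-mono i<j j<m)
    ; Z-mono = λ i<j j<m → +-monoʳ-< (L + M₁ + M₂) (ζ-mono i<j j<m)
    ; L≤X = λ i → m≤m+n L (ξ i)
    ; X<Y = x<y
    ; Y<Z = y<z
    ; Z<π = z<π
    ; witness = λ {i} {j} {k} i<m j<m k<m →
        good-triple⇒Witness d π (m≤m+n L (ξ i)) (x<y j i<m) (y<z k j<m) (z<π k<m) (complete i<m j<m k<m)
    }
    where
    x<y : ∀ {i} j → i < m → L + ξ i < L + M₁ + η j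
    x<y j i<m = <-≤-trans (+-monoʳ-< L (ξ< i<m)) (m≤m+n (L + M₁) (η j))
    y<z : ∀ {i} j → i < m → L + M₁ + η i < L + M₁ + M₂ + ζ j
    y<z j i<m = <-≤-trans (+-monoʳ-< (L + M₁) (η< i<m)) (m≤m+n (L + M₁ + M₂) (ζ j))
    z<π : ∀ {k} → k < m → L + M₁ + M₂ + ζ k < length π
    z<π k<m = <-≤-trans (+-monoʳ-< (L + M₁ + M₂) (ζ< k<m)) (≤-reflexive (sym (trans (↭-length π↭) (trans |xs| n≡))))

-- Subsets given by prefixes and positions

toSet : List (Fin n) → Subset n
toSet []      = ∅
toSet (x ∷ l) = ⁅ x ⁆ ∪ toSet l

∈-toSet⁺ : {l : List (Fin n)} {x : Fin n} → x ∈ l → x ∈ˢ toSet l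
∈-toSet⁺ (here refl) = x∈p∪q⁺ (inj₁ (x∈⁅x⁆ _))
∈-toSet⁺ (there x∈l) = x∈p∪q⁺ (inj₂ (∈-toSet⁺ x∈l))

∈-toSet⁻ : (l : List (Fin n)) {x : Fin n} → x ∈ˢ toSet l → x ∈ l
∈-toSet⁻ []      x∈ = ⊥-elim (∉⊥ x∈)
∈-toSet⁻ (y ∷ l) x∈ with x∈p∪q⁻ ⁅ y ⁆ (toSet l) x∈
... | inj₁ x∈y = here (x∈⁅y⁆⇒x≡y y x∈y)
... | inj₂ x∈l = there (∈-toSet⁻ l x∈l)

toSet-mono : (l m : List (Fin n)) → (∀ {x} → x ∈ l → x ∈ m) → toSet l ⊆ toSet m
toSet-mono l m l⊆m x∈ = ∈-toSet⁺ (l⊆m (∈-toSet⁻ l x∈))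

toSet-↭ : {l m : List (Fin n)} → l ↭ m → toSet l ≡ toSet m
toSet-↭ {l = l} {m} l↭m = ⊆-antisym (toSet-mono l m (∈-resp-↭ l↭m)) (toSet-mono m l (∈-resp-↭ (↭-sym l↭m)))

toSet-reflects-∈ : (l m : List (Fin n)) → toSet l ≡ toSet m → ∀ {x} → x ∈ l → x ∈ m
toSet-reflects-∈ l m eq x∈l = ∈-toSet⁻ m (subst (_ ∈ˢ_) eq (∈-toSet⁺ x∈l))

module _ {A : Set} (d : A) where

  at-∈ : ∀ (l : List A) {p} → p < length l → at d l p ∈ l
  at-∈ (x ∷ l) {zero}  _         = here refl
  at-∈ (x ∷ l) {suc p} (s≤s p<l) = there (at-∈ l p<l)

  at-injective : ∀ {l : List A} {p q} → Unique l → p < length l → q < length l → at d l p ≡ at d l q → p ≡ q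
  at-injective {x ∷ l} {zero}  {zero}  _        _         _         _  = refl
  at-injective {x ∷ l} {zero}  {suc q} (x∉ ∷ _) _         (s≤s q<l) eq = ⊥-elim (All.lookup x∉ (at-∈ l q<l) eq)
  at-injective {x ∷ l} {suc p} {zero}  (x∉ ∷ _) (s≤s p<l) _         eq = ⊥-elim (All.lookup x∉ (at-∈ l p<l) (sym eq))
  at-injective {x ∷ l} {suc p} {suc q} (_ ∷ u)  (s≤s p<l) (s≤s q<l) eq = cong suc (at-injective u p<l q<l eq)

  ∈-take⁻ : ∀ k (l : List A) {x} → x ∈ take k l → ∃[ q ] q < k × q < length l × at d l q ≡ x
  ∈-take⁻ (suc k) (y ∷ l) (here refl) = 0 , s≤s z≤n , s≤s z≤n , refl
  ∈-take⁻ (suc k) (y ∷ l) (there x∈)  = let q , q<k , q<l , eq = ∈-take⁻ k l x∈ in suc q , s≤s q<k , s≤s q<l , eq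

  ∈-take⁺ : ∀ {k} (l : List A) {p} → p < k → p < length l → at d l p ∈ take k l
  ∈-take⁺ (y ∷ l) {zero}  (s≤s _)   _         = here refl
  ∈-take⁺ (y ∷ l) {suc p} (s≤s p<k) (s≤s p<l) = there (∈-take⁺ l p<k p<l)

  ∈-take-mono : ∀ {i j} (l : List A) → i ≤ j → ∀ {x} → x ∈ take i l → x ∈ take j l
  ∈-take-mono {i} {j} l i≤j x∈ with ∈-take⁻ i l x∈
  ... | q , q<i , q<l , refl = ∈-take⁺ l (<-≤-trans q<i i≤j) q<l

  pick : List A → List ℕ → ℕ → List A
  pick l ps i = map (at d l) ps ++ take i l

  pick-∈ : ∀ {l : List A} {ps i p} → Unique l → All (_< length l) ps → i ≤ p → p < length l →
           at d l p ∈ pick l ps i → p ∈ ps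
  pick-∈ {l} {ps} {i} u ps<l i≤p p<l p∈ with ∈-++⁻ (map (at d l) ps) p∈
  ... | inj₁ p∈ps with ∈-map⁻ (at d l) p∈ps
  ...   | q , q∈ , eq rewrite at-injective u p<l (All.lookup ps<l q∈) eq = q∈
  pick-∈ {l} {ps} {i} u ps<l i≤p p<l p∈ | inj₂ p∈take with ∈-take⁻ i l p∈take
  ...   | q , q<i , q<l , eq = ⊥-elim (<⇒≱ q<i (≤-trans i≤p (≤-reflexive (at-injective u p<l q<l (sym eq)))))

  pick-mono : ∀ (l : List A) {ps qs i j} → (∀ {p} → p ∈ ps → p ∈ qs) → i ≤ j → ∀ {x} → x ∈ pick l ps i → x ∈ pick l qs j
  pick-mono l {ps} {qs} {i} ps⊆qs i≤j x∈ with ∈-++⁻ (map (at d l) ps) x∈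
  ... | inj₂ x∈take = ∈-++⁺ʳ (map (at d l) qs) (∈-take-mono l i≤j x∈take)
  ... | inj₁ x∈ps with ∈-map⁻ (at d l) x∈ps
  ...   | p , p∈ , refl = ∈-++⁺ˡ (∈-map⁺ (at d l) (ps⊆qs p∈))

-- Crowns in a family, and long chains

record CrownIn (t : ℕ) (F : Family n) : Set where
  field
    set       : CrownElt t → Subset n
    set∈      : ∀ u → set u ∈ sets F
    injective : ∀ {u v} → set u ≡ set v → u ≡ v
    a⊆b       : ∀ i → set (inj₁ i) ⊆ set (inj₂ i)
    a′⊆b      : ∀ i j → NextMod t i j → set (inj₁ j) ⊆ set (inj₂ i)

CrownIn⇒¬CrownFree : {F : Family n} → CrownIn t F → ¬ CrownFree t F
CrownIn⇒¬CrownFree {t = t} {F} crown free = free (f , f-injective , f-mono)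
  where
  open CrownIn crown
  f : CrownElt t → Fin (length (sets F))
  f u = Any.index (set∈ u)
  member-f : ∀ u → set u ≡ member F (f u)
  member-f u = lookup-index (set∈ u)
  f-injective : ∀ {u v} → f u ≡ f v → u ≡ v
  f-injective {u} {v} eq = injective (trans (member-f u) (trans (cong (member F) eq) (sym (member-f v))))
  f-mono : ∀ u v → CrownLe t u v → member F (f u) ⊆ member F (f v)
  f-mono u v u≤v rewrite sym (member-f u) | sym (member-f v) with u≤v
  ... | crefl _      = id
  ... | a≤b i        = a⊆b i
  ... | a'≤b i j nxt = a′⊆b i j nxt

-- A chain of 2t distinct members carries a linear extension of the crown; `rank` puts all lower
-- elements before all upper ones.
chain⇒crown : (d : Fin n) {F : Family n} (π : List (Fin n)) → Unique π → (ι : ℕ → ℕ) →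
  (∀ {i} → i < t + t → ι i < length π × toSet (take (suc (ι i)) π) ∈ sets F) →
  (∀ {i j} → i < j → j < t + t → ι i < ι j) → CrownIn t F
chain⇒crown {n} {t = t} d {F} π unique ι ok mono = record
  { set = S ∘ rank
  ; set∈ = λ u → proj₂ (ok (rank< u))
  ; injective = λ {u} {v} eq → rank-injective u v (S-injective (rank< u) (rank< v) eq)
  ; a⊆b = λ i → below i i
  ; a′⊆b = λ i j _ → below j i
  }
  where
  S : ℕ → Subset n
  S i = toSet (take (suc (ι i)) π)
  rank : CrownElt t → ℕ
  rank (inj₁ i) = toℕ i
  rank (inj₂ i) = t + toℕ i
  rank< : ∀ u → rank u < t + t
  rank< (inj₁ i) = <-≤-trans (toℕ<n i) (m≤m+n t t)
  rank< (inj₂ i) = +-monoʳ-< t (toℕ<n i)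
  rank-injective : ∀ u v → rank u ≡ rank v → u ≡ v
  rank-injective (inj₁ i) (inj₁ j) eq = cong inj₁ (toℕ-injective eq)
  rank-injective (inj₁ i) (inj₂ j) eq = ⊥-elim (<⇒≱ (toℕ<n i) (≤-trans (m≤m+n t (toℕ j)) (≤-reflexive (sym eq))))
  rank-injective (inj₂ i) (inj₁ j) eq = ⊥-elim (<⇒≱ (toℕ<n j) (≤-trans (m≤m+n t (toℕ i)) (≤-reflexive eq)))
  rank-injective (inj₂ i) (inj₂ j) eq = cong inj₂ (toℕ-injective (+-cancelˡ-≡ t _ _ eq))
  distinct : ∀ {i j} → i < j → j < t + t → S i ≢ S j
  -- The entry at position `ι j` belongs to the longer prefix only.
  distinct {i} {j} i<j j< eq with pick-∈ d {π} {[]} unique [] (mono i<j j<) (proj₁ (ok j<))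
    (toSet-reflects-∈ (take (suc (ι j)) π) (take (suc (ι i)) π) (sym eq) (∈-take⁺ d π ≤-refl (proj₁ (ok j<))))
  ... | ()
  S-injective : ∀ {i j} → i < t + t → j < t + t → S i ≡ S j → i ≡ j
  S-injective {i} {j} i< j< eq with <-cmp i j
  ... | tri< i<j _ _ = ⊥-elim (distinct i<j j< eq)
  ... | tri≈ _ i≡j _ = i≡j
  ... | tri> _ _ j<i = ⊥-elim (distinct j<i i< (sym eq))
  below : ∀ i j → S (toℕ i) ⊆ S (t + toℕ j)
  below i j = toSet-mono _ _ (∈-take-mono d π (s≤s (<⇒≤ (mono (<-≤-trans (toℕ<n i) (m≤m+n t (toℕ j))) (+-monoʳ-< t (toℕ<n j))))))

-- A closed walk of odd length in the grid

-- `nothing` marks a free coordinate: cells with exactly one are axis-parallel lines, cells with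
-- none are grid points. A common type lets one injectivity argument serve both halves of the crown.
Cell : Set
Cell = Maybe ℕ × Maybe ℕ × Maybe ℕ

Point : Set
Point = ℕ × ℕ × ℕ

full : Point → Cell
full (x , y , z) = just x , just y , just z

data _◁_ : Cell → Point → Set where
  yz : ∀ {x y z} → (nothing , just y , just z) ◁ (x , y , z)
  xz : ∀ {x y z} → (just x , nothing , just z) ◁ (x , y , z)
  xy : ∀ {x y z} → (just x , just y , nothing) ◁ (x , y , z)

-- A closed walk of odd length 2s + 7 in a three-dimensional grid, along pairwise distinct axis-parallel lines:
-- the diagonal staircase (i,i,0), (i+1,i,0), …, (s+2,s+1,0), then (s+2,0,0), (s+2,0,1), (0,0,1) and back to (0,0,0).
module Walk (s : ℕ) where

  data Step : Set where
    even odd : ℕ → Step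
    corner₁ corner₂ corner₃ : Step

  next : Step → Step
  next (even i) = odd i
  next (odd i) with i ≟ suc s
  ... | yes _ = corner₁
  ... | no  _ = even (suc i)
  next corner₁ = corner₂
  next corner₂ = corner₃
  next corner₃ = even 0

  point : Step → Point
  point (even i) = i , i , 0
  point (odd i)  = suc i , i , 0
  point corner₁  = 2 + s , 0 , 0
  point corner₂  = 2 + s , 0 , 1
  point corner₃  = 0 , 0 , 1

  -- The line through the point of a step and the point before it.
  line : Step → Cell
  line (even zero)    = just 0 , just 0 , nothing
  line (even (suc i)) = just (suc i) , nothing , just 0
  line (odd i)        = nothing , just i , just 0
  line corner₁        = just (2 + s) , nothing , just 0
  line corner₂        = just (2 + s) , just 0 , nothing
  line corner₃        = nothing , just 0 , just 1

  line◁point : ∀ v → line v ◁ point v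
  line◁point (even zero)    = xy
  line◁point (even (suc i)) = xz
  line◁point (odd i)        = yz
  line◁point corner₁        = xz
  line◁point corner₂        = xy
  line◁point corner₃        = yz

  line-next◁point : ∀ v → line (next v) ◁ point v
  line-next◁point (even i) = yz
  line-next◁point (odd i) with i ≟ suc s
  ... | yes refl = xz
  ... | no  _    = xz
  line-next◁point corner₁  = xy
  line-next◁point corner₂  = yz
  line-next◁point corner₃  = xy

  last : ℕ
  last = 2 + ((2 + s) + (2 + s))

  index : Step → ℕ
  index (even i) = i + i
  index (odd i)  = suc (i + i)
  index corner₁  = (2 + s) + (2 + s)
  index corner₂  = suc ((2 + s) + (2 + s))
  index corner₃  = last

  Valid : Step → Set
  Valid (even i) = i ≤ suc s
  Valid (odd i)  = i ≤ suc s
  Valid corner₁  = ⊤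
  Valid corner₂  = ⊤
  Valid corner₃  = ⊤

  staircase<last : ∀ {i} → i ≤ suc s → suc (i + i) < last
  staircase<last i≤ = s≤s (s≤s (≤-trans (+-mono-≤ i≤ i≤) (+-mono-≤ (n≤1+n (suc s)) (n≤1+n (suc s)))))

  next-valid : ∀ v → Valid v → index v < last → Valid (next v) × index (next v) ≡ suc (index v)
  next-valid (even i) i≤ _ = i≤ , refl
  next-valid (odd i)  i≤ _ with i ≟ suc s
  ... | yes refl = tt , cong suc (+-suc (suc s) (suc s))
  ... | no  i≢   = ≤∧≢⇒< i≤ i≢ , cong suc (+-suc i i)
  next-valid corner₁ _ _ = tt , refl
  next-valid corner₂ _ _ = tt , refl
  next-valid corner₃ _ last<last = ⊥-elim (<-irrefl refl last<last)

  step : ℕ → Step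
  step zero    = even 0
  step (suc k) = next (step k)

  step-valid : ∀ k → k ≤ last → Valid (step k) × index (step k) ≡ k
  step-valid zero    _   = z≤n , refl
  step-valid (suc k) k<last with step k | step-valid k (<⇒≤ k<last)
  ... | v | valid , refl = next-valid v valid k<last

  final-step : ∀ v → Valid v → index v ≡ last → v ≡ corner₃
  final-step (even i) i≤ eq = ⊥-elim (<-irrefl eq (<-trans (n<1+n _) (staircase<last i≤)))
  final-step (odd i)  i≤ eq = ⊥-elim (<-irrefl eq (staircase<last i≤))
  final-step corner₁  _  eq = ⊥-elim (<-irrefl eq (m≤n+m _ 1))
  final-step corner₂  _  eq = ⊥-elim (<-irrefl eq ≤-refl)
  final-step corner₃  _  _  = refl

  closes : next (step last) ≡ step 0
  closes with step last | step-valid last ≤-refl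
  ... | v | valid , eq rewrite final-step v valid eq = refl

  -- A left inverse that recovers the index of a step, so distinct steps have distinct points;
  -- `decodeLine` does the same for lines. A staircase point has index x + y. The first clause
  -- singles out `corner₁`, since staircase points with y = 0 have x at most 1.
  decodePoint : Cell → ℕ
  decodePoint (just (suc (suc x)) , just zero , just zero) = suc (suc x) + suc (suc x)
  decodePoint (just x , just y , just zero)                = x + y
  decodePoint (just zero , _ , _)                          = last
  decodePoint _                                            = suc ((2 + s) + (2 + s))

  decodeLine : Cell → ℕ
  decodeLine (just zero , just _ , nothing)    = 0
  decodeLine (just (suc _) , just _ , nothing) = suc ((2 + s) + (2 + s))
  decodeLine (just x , nothing , _)            = x + x
  decodeLine (nothing , just y , just zero)    = suc (y + y)
  decodeLine _                                 = last

  decodePoint-point : ∀ v → decodePoint (full (point v)) ≡ index v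
  decodePoint-point (even zero)          = refl
  decodePoint-point (even (suc zero))    = refl
  decodePoint-point (even (suc (suc i))) = refl
  decodePoint-point (odd zero)           = refl
  decodePoint-point (odd (suc zero))     = refl
  decodePoint-point (odd (suc (suc i)))  = refl
  decodePoint-point corner₁              = refl
  decodePoint-point corner₂              = refl
  decodePoint-point corner₃              = refl

  decodeLine-line : ∀ v → decodeLine (line v) ≡ index v
  decodeLine-line (even zero)    = refl
  decodeLine-line (even (suc i)) = refl
  decodeLine-line (odd i)        = refl
  decodeLine-line corner₁        = refl
  decodeLine-line corner₂        = refl
  decodeLine-line corner₃        = refl

  Bounded : ℕ → Point → Set
  Bounded m (x , y , z) = x < m × y < m × z < m

  point-bounded : ∀ v → Valid v → Bounded (suc last) (point v)
  point-bounded (even i) i≤ = i< , i< , s≤s z≤n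
    where i< = s≤s (≤-trans (m≤m+n i i) (<⇒≤ (<-trans (n<1+n _) (staircase<last i≤))))
  point-bounded (odd i) i≤ = s≤s i< , ≤-trans i< (n≤1+n _) , s≤s z≤n
    where i< = ≤-trans (s≤s (m≤m+n i i)) (<⇒≤ (staircase<last i≤))
  point-bounded corner₁ _ = s≤s (≤-trans (m≤m+n (2 + s) (2 + s)) (m≤n+m _ 2)) , s≤s z≤n , s≤s z≤n
  point-bounded corner₂ _ = s≤s (≤-trans (m≤m+n (2 + s) (2 + s)) (m≤n+m _ 2)) , s≤s z≤n , s≤s (s≤s z≤n)
  point-bounded corner₃ _ = s≤s z≤n , s≤s z≤n , s≤s (s≤s z≤n)

-- From a grid to a crown

least : ℕ → (ℕ → Bool) → ℕ
least zero    ψ = 0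
least (suc n) ψ with ψ 0
... | true  = 0
... | false = suc (least n (ψ ∘ suc))

least-spec : ∀ {i n} (ψ : ℕ → Bool) → i ≤ n → ψ i ≡ true → least n ψ ≤ i × ψ (least n ψ) ≡ true
least-spec {n = zero}  ψ z≤n ψi = z≤n , ψi
least-spec {i} {suc n} ψ i≤n ψi with ψ 0 in ψ0
... | true  = z≤n , ψ0
least-spec {zero}  {suc n} ψ z≤n       ψi | false with () ← trans (sym ψi) ψ0
least-spec {suc i} {suc n} ψ (s≤s i≤n) ψi | false =
  let least≤ , ψleast = least-spec (ψ ∘ suc) i≤n ψi in s≤s least≤ , ψleast

maybe-ext : {a b : Maybe ℕ} → (∀ {i} → a ≡ just i → b ≡ just i) → (∀ {i} → b ≡ just i → a ≡ just i) → a ≡ b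
maybe-ext {just i}  f g = sym (f refl)
maybe-ext {nothing} {just i}  f g = g refl
maybe-ext {nothing} {nothing} f g = refl

optional : (ℕ → ℕ) → Maybe ℕ → List ℕ
optional f (just i) = f i ∷ []
optional f nothing  = []

optional⁻ : ∀ f a {p} → p ∈ optional f a → ∃[ i ] a ≡ just i × p ≡ f i
optional⁻ f (just i) (here eq) = i , refl , eq

increasing-injective : ∀ {m} {f : ℕ → ℕ} → (∀ {i j} → i < j → j < m → f i < f j) →
  ∀ {i j} → i < m → j < m → f i ≡ f j → i ≡ j
increasing-injective mono {i} {j} i< j< eq with <-cmp i j
... | tri< i<j _ _ = ⊥-elim (<-irrefl eq (mono i<j j<))
... | tri≈ _ i≡j _ = i≡j
... | tri> _ _ j<i = ⊥-elim (<-irrefl (sym eq) (mono j<i i<))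

module GridCrown {n : ℕ} (F : Family n) (φ : List (Fin n) → Bool) (φ-↭ : ∀ {l m} → l ↭ m → φ l ≡ φ m)
  (r L : ℕ) (r≤ : ∀ l → φ l ≡ true → r ≤ length l) (≤L : ∀ l → φ l ≡ true → length l ≤ L)
  (φ⇒∈ : ∀ l → φ l ≡ true → toSet l ∈ sets F) where

  open Grids φ φ-↭ r L r≤ ≤L

  module _ (d : Fin n) (m : ℕ) (π : List (Fin n)) (unique : Unique π) (grid : Grid d m π) where

    open Grid grid

    positions : Cell → List ℕ
    positions (a , b , c) = optional X a ++ optional Y b ++ optional Z c

    InRange : Maybe ℕ → Set
    InRange a = ∀ {i} → a ≡ just i → i < m

    CellInRange : Cell → Set
    CellInRange (a , b , c) = InRange a × InRange b × InRange c

    positions⁻ : ∀ {a b c p} → p ∈ positions (a , b , c) →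
      (∃[ i ] a ≡ just i × p ≡ X i) ⊎ (∃[ i ] b ≡ just i × p ≡ Y i) ⊎ (∃[ i ] c ≡ just i × p ≡ Z i)
    positions⁻ {a} {b} {c} p∈ with ∈-++⁻ (optional X a) p∈
    ... | inj₁ p∈X = inj₁ (optional⁻ X a p∈X)
    ... | inj₂ p∈′ with ∈-++⁻ (optional Y b) p∈′
    ...   | inj₁ p∈Y = inj₂ (inj₁ (optional⁻ Y b p∈Y))
    ...   | inj₂ p∈Z = inj₂ (inj₂ (optional⁻ Z c p∈Z))

    X<Z : ∀ {i} k → i < m → X i < Z k
    X<Z {i} k i<m = <-trans (X<Y i i<m) (Y<Z k i<m)

    X-position : ∀ {a b c i} → CellInRange (a , b , c) → i < m → X i ∈ positions (a , b , c) → a ≡ just i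
    X-position {a} {b} {c} (a< , b< , c<) i<m p∈ with positions⁻ {a} {b} {c} p∈
    ... | inj₁ (j , refl , eq)        = cong just (sym (increasing-injective X-mono i<m (a< refl) eq))
    ... | inj₂ (inj₁ (j , refl , eq)) = ⊥-elim (<-irrefl eq (X<Y j i<m))
    ... | inj₂ (inj₂ (j , refl , eq)) = ⊥-elim (<-irrefl eq (X<Z j i<m))

    Y-position : ∀ {a b c i} → CellInRange (a , b , c) → i < m → Y i ∈ positions (a , b , c) → b ≡ just i
    Y-position {a} {b} {c} (a< , b< , c<) i<m p∈ with positions⁻ {a} {b} {c} p∈
    ... | inj₁ (j , refl , eq)        = ⊥-elim (<-irrefl (sym eq) (X<Y _ (a< refl)))
    ... | inj₂ (inj₁ (j , refl , eq)) = cong just (sym (increasing-injective Y-mono i<m (b< refl) eq))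
    ... | inj₂ (inj₂ (j , refl , eq)) = ⊥-elim (<-irrefl eq (Y<Z j i<m))

    Z-position : ∀ {a b c i} → CellInRange (a , b , c) → i < m → Z i ∈ positions (a , b , c) → c ≡ just i
    Z-position {a} {b} {c} (a< , b< , c<) i<m p∈ with positions⁻ {a} {b} {c} p∈
    ... | inj₁ (j , refl , eq)        = ⊥-elim (<-irrefl (sym eq) (X<Z _ (a< refl)))
    ... | inj₂ (inj₁ (j , refl , eq)) = ⊥-elim (<-irrefl (sym eq) (Y<Z _ (b< refl)))
    ... | inj₂ (inj₂ (j , refl , eq)) = cong just (sym (increasing-injective Z-mono i<m (c< refl) eq))

    Y<π : ∀ {i} → i < m → Y i < length π
    Y<π {i} i<m = <-trans (Y<Z i i<m) (Z<π i<m)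

    X<π : ∀ {i} → i < m → X i < length π
    X<π {i} i<m = <-trans (X<Y i i<m) (Y<π i<m)

    L≤Y : ∀ {i} → i < m → L ≤ Y i
    L≤Y {i} i<m = ≤-trans (L≤X i) (<⇒≤ (X<Y i i<m))

    L≤Z : ∀ {i} → i < m → L ≤ Z i
    L≤Z {i} i<m = ≤-trans (L≤X i) (<⇒≤ (X<Z i i<m))

    positions<π : ∀ {e} → CellInRange e → All (_< length π) (positions e)
    positions<π {a , b , c} (a< , b< , c<) = All.tabulate (λ p∈ → bound (positions⁻ {a} {b} {c} p∈))
      where
      bound : ∀ {p} → (∃[ i ] a ≡ just i × p ≡ X i) ⊎ (∃[ i ] b ≡ just i × p ≡ Y i) ⊎ (∃[ i ] c ≡ just i × p ≡ Z i) →
              p < length π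
      bound (inj₁ (i , a≡ , refl))        = X<π (a< a≡)
      bound (inj₂ (inj₁ (i , b≡ , refl))) = Y<π (b< b≡)
      bound (inj₂ (inj₂ (i , c≡ , refl))) = Z<π (c< c≡)

    elements : Cell → ℕ → List (Fin n)
    elements e i = pick d π (positions e) i

    position-transfer : ∀ {e e′ i i′ p} → CellInRange e′ → i′ ≤ L → L ≤ p → p < length π →
      toSet (elements e i) ≡ toSet (elements e′ i′) → p ∈ positions e → p ∈ positions e′
    position-transfer {e} {e′} {i} {i′} e′< i′≤L L≤p p<π eq p∈ =
      pick-∈ d {l = π} unique (positions<π e′<) (≤-trans i′≤L L≤p) p<π
        (toSet-reflects-∈ (elements e i) (elements e′ i′) eq (∈-++⁺ˡ (∈-map⁺ (at d π) p∈)))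

    -- Grid positions start at `L` and the prefixes stop there, so the elements of the set beyond
    -- `L` are exactly those of the cell. Since the entries of `π` are distinct and the three
    -- coordinates use disjoint ranges of positions, they determine the cell.
    cell-unique : ∀ {e e′ i i′} → CellInRange e → CellInRange e′ → i ≤ L → i′ ≤ L →
      toSet (elements e i) ≡ toSet (elements e′ i′) → e ≡ e′
    cell-unique {a , b , c} {a′ , b′ , c′} {i} {i′} e< e′< i≤L i′≤L eq =
      cong₂ _,_ (maybe-ext (x-coordinate e< e′< i′≤L eq) (x-coordinate e′< e< i≤L (sym eq)))
      (cong₂ _,_ (maybe-ext (y-coordinate e< e′< i′≤L eq) (y-coordinate e′< e< i≤L (sym eq)))
                 (maybe-ext (z-coordinate e< e′< i′≤L eq) (z-coordinate e′< e< i≤L (sym eq))))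
      where
      x-coordinate : ∀ {a b c a′ b′ c′ i i′} → CellInRange (a , b , c) → CellInRange (a′ , b′ , c′) → i′ ≤ L →
        toSet (elements (a , b , c) i) ≡ toSet (elements (a′ , b′ , c′) i′) → ∀ {j} → a ≡ just j → a′ ≡ just j
      x-coordinate {b = b} {c} {a′} {b′} {c′} {i} e< e′< i′≤L eq {j} refl = X-position e′< j<m
        (position-transfer {e = just j , b , c} {a′ , b′ , c′} {i} e′< i′≤L (L≤X j) (X<π j<m) eq (here refl))
        where j<m = proj₁ e< refl
      y-coordinate : ∀ {a b c a′ b′ c′ i i′} → CellInRange (a , b , c) → CellInRange (a′ , b′ , c′) → i′ ≤ L →
        toSet (elements (a , b , c) i) ≡ toSet (elements (a′ , b′ , c′) i′) → ∀ {j} → b ≡ just j → b′ ≡ just j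
      y-coordinate {a} {c = c} {a′} {b′} {c′} {i} e< e′< i′≤L eq {j} refl = Y-position e′< j<m
        (position-transfer {e = a , just j , c} {a′ , b′ , c′} {i} e′< i′≤L (L≤Y j<m) (Y<π j<m) eq
          (∈-++⁺ʳ (optional X a) (here refl)))
        where j<m = proj₁ (proj₂ e<) refl
      z-coordinate : ∀ {a b c a′ b′ c′ i i′} → CellInRange (a , b , c) → CellInRange (a′ , b′ , c′) → i′ ≤ L →
        toSet (elements (a , b , c) i) ≡ toSet (elements (a′ , b′ , c′) i′) → ∀ {j} → c ≡ just j → c′ ≡ just j
      z-coordinate {a} {b} {a′ = a′} {b′} {c′} {i} e< e′< i′≤L eq {j} refl = Z-position e′< j<m
        (position-transfer {e = a , b , just j} {a′ , b′ , c′} {i} e′< i′≤L (L≤Z j<m) (Z<π j<m) eq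
          (∈-++⁺ʳ (optional X a) (∈-++⁺ʳ (optional Y b) (here refl))))
        where j<m = proj₂ (proj₂ e<) refl

    -- A line shared by two points of the walk needs one level that is below the levels of both, hence the least one.
    lineLevel : Cell → ℕ
    lineLevel e = least L (λ i → φ (elements e i))

    module _ {x y z : ℕ} (x< : x < m) (y< : y < m) (z< : z < m) where

      open Witness (witness x< y< z<) public

      point-inRange : CellInRange (full (x , y , z))
      point-inRange = (λ { refl → x< }) , (λ { refl → y< }) , (λ { refl → z< })

      line-inRange : ∀ {e} → e ◁ (x , y , z) → CellInRange e
      line-inRange yz = (λ ()) , (λ { refl → y< }) , (λ { refl → z< })
      line-inRange xz = (λ { refl → x< }) , (λ ()) , (λ { refl → z< })
      line-inRange xy = (λ { refl → x< }) , (λ { refl → y< }) , (λ ())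

      line-witness : ∀ {e} → e ◁ (x , y , z) → ∃[ i ] i ≤ level × φ (elements e i) ≡ true
      line-witness yz = φyz
      line-witness xz = φxz
      line-witness xy = φxy

      line-spec : ∀ {e} → e ◁ (x , y , z) → lineLevel e ≤ level × φ (elements e (lineLevel e)) ≡ true
      line-spec {e} e◁ with line-witness e◁
      ... | i , i≤ , φi with least-spec (λ i → φ (elements e i)) (≤-trans i≤ level≤) φi
      ...   | least≤ , φleast = ≤-trans least≤ i≤ , φleast

      line-positions : ∀ {e} → e ◁ (x , y , z) → ∀ {p} → p ∈ positions e → p ∈ positions (full (x , y , z))
      line-positions yz p∈                 = there p∈
      line-positions xz (here eq)          = here eq
      line-positions xz (there p∈)         = there (there p∈)
      line-positions xy (here eq)          = here eq
      line-positions xy (there (here eq))  = there (here eq)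

      line⊆point : ∀ {e} → e ◁ (x , y , z) → toSet (elements e (lineLevel e)) ⊆ toSet (elements (full (x , y , z)) level)
      line⊆point {e} e◁ = toSet-mono (elements e (lineLevel e)) (elements (full (x , y , z)) level)
        (pick-mono d π (line-positions e◁) (proj₁ (line-spec e◁)))

  -- Lower element i is the line of step i and upper element i its point. The line passes also
  -- through the previous point of the walk, which gives the other cover relation, and `closes`
  -- supplies the one that wraps around. All coordinates of the walk are at most `last`, so a grid
  -- of side t is large enough.
  grid⇒crown : ∀ s d π → Unique π → Grid d (suc (Walk.last s)) π → CrownIn (suc (Walk.last s)) F
  grid⇒crown s d π unique grid = record
    { set = set
    ; set∈ = set∈
    ; injective = λ {u} {v} → injective u v
    ; a⊆b = λ i → line⊆point′ (line (at-step i)) i (line◁point (at-step i))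
    ; a′⊆b = λ i j nxt → line⊆point′ (line (at-step j)) i (subst (λ v → line v ◁ point (at-step i)) (next≡ i j nxt) (line-next◁point (at-step i)))
    }
    where
    open Walk s
    m = suc last
    at-step : Fin m → Step
    at-step i = step (toℕ i)
    spec : ∀ i → Valid (at-step i) × index (at-step i) ≡ toℕ i
    spec i = step-valid (toℕ i) (≤-pred (toℕ<n i))
    bounded : ∀ i → Bounded m (point (at-step i))
    bounded i = point-bounded (at-step i) (proj₁ (spec i))
    x< = λ i → proj₁ (bounded i)
    y< = λ i → proj₁ (proj₂ (bounded i))
    z< = λ i → proj₂ (proj₂ (bounded i))
    pointLevel : Fin m → ℕ
    pointLevel i = level d m π unique grid (x< i) (y< i) (z< i)
    pointLevel≤ : ∀ i → pointLevel i ≤ L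
    pointLevel≤ i = level≤ d m π unique grid (x< i) (y< i) (z< i)
    cell : CrownElt m → Cell
    cell (inj₁ i) = line (at-step i)
    cell (inj₂ i) = full (point (at-step i))
    lev : CrownElt m → ℕ
    lev (inj₁ i) = lineLevel d m π unique grid (line (at-step i))
    lev (inj₂ i) = pointLevel i
    set : CrownElt m → Subset n
    set u = toSet (elements d m π unique grid (cell u) (lev u))
    set∈ : ∀ u → set u ∈ sets F
    set∈ (inj₁ i) = φ⇒∈ _ (proj₂ (line-spec d m π unique grid (x< i) (y< i) (z< i) (line◁point (at-step i))))
    set∈ (inj₂ i) = φ⇒∈ _ (φxyz d m π unique grid (x< i) (y< i) (z< i))
    inRange : ∀ u → CellInRange d m π unique grid (cell u)
    inRange (inj₁ i) = line-inRange d m π unique grid (x< i) (y< i) (z< i) (line◁point (at-step i))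
    inRange (inj₂ i) = point-inRange d m π unique grid (x< i) (y< i) (z< i)
    lev≤ : ∀ u → lev u ≤ L
    lev≤ (inj₁ i) = ≤-trans (proj₁ (line-spec d m π unique grid (x< i) (y< i) (z< i) (line◁point (at-step i)))) (pointLevel≤ i)
    lev≤ (inj₂ i) = pointLevel≤ i
    same-step : ∀ {i j} → index (at-step i) ≡ index (at-step j) → i ≡ j
    same-step {i} {j} eq = toℕ-injective (trans (sym (proj₂ (spec i))) (trans eq (proj₂ (spec j))))
    line≢point : ∀ {e p q} → e ◁ p → e ≢ full q
    line≢point yz ()
    line≢point xz ()
    line≢point xy ()
    cell-injective : ∀ u v → cell u ≡ cell v → u ≡ v
    cell-injective (inj₁ i) (inj₁ j) eq = cong inj₁ (same-step
      (trans (sym (decodeLine-line (at-step i))) (trans (cong decodeLine eq) (decodeLine-line (at-step j)))))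
    cell-injective (inj₁ i) (inj₂ j) eq = ⊥-elim (line≢point (line◁point (at-step i)) eq)
    cell-injective (inj₂ i) (inj₁ j) eq = ⊥-elim (line≢point (line◁point (at-step j)) (sym eq))
    cell-injective (inj₂ i) (inj₂ j) eq = cong inj₂ (same-step
      (trans (sym (decodePoint-point (at-step i))) (trans (cong decodePoint eq) (decodePoint-point (at-step j)))))
    injective : ∀ u v → set u ≡ set v → u ≡ v
    injective u v eq = cell-injective u v (cell-unique d m π unique grid (inRange u) (inRange v) (lev≤ u) (lev≤ v) eq)
    line⊆point′ : ∀ e i → e ◁ point (at-step i) →
      toSet (elements d m π unique grid e (lineLevel d m π unique grid e)) ⊆ set (inj₂ i)
    line⊆point′ e i = line⊆point d m π unique grid (x< i) (y< i) (z< i)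
    next≡ : ∀ i j → NextMod m i j → next (at-step i) ≡ at-step j
    next≡ i j (inj₁ si≡j)         = cong step si≡j
    next≡ i j (inj₂ (si≡m , j≡0)) = trans (cong (next ∘ step) (suc-injective si≡m)) (trans closes (cong step (sym j≡0)))

-- Factorials and the middle binomial coefficient

-- Both sides are a!·q! times `d` further factors; each factor a + i on the left faces the larger q
-- + i on the right.
!-balanced : ∀ a q d → a ≤ q → (a + d) ! * q ! ≤ a ! * (q + d) !
!-balanced a q zero    a≤q rewrite +-identityʳ a | +-identityʳ q = ≤-refl
!-balanced a q (suc d) a≤q rewrite +-suc a d | +-suc q d = begin
  suc (a + d) * (a + d) ! * q !      ≡⟨ *-assoc (suc (a + d)) ((a + d) !) (q !) ⟩
  suc (a + d) * ((a + d) ! * q !)    ≤⟨ *-mono-≤ (s≤s (+-monoˡ-≤ d a≤q)) (!-balanced a q d a≤q) ⟩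
  suc (q + d) * (a ! * (q + d) !)    ≡⟨ arith (suc (q + d)) (a !) ((q + d) !) ⟩
  a ! * (suc (q + d) * (q + d) !)    ∎
  where
  open ≤-Reasoning
  arith : ∀ x y z → x * (y * z) ≡ y * (x * z)
  arith = solve-∀

half≤rest : ∀ n → n / 2 ≤ n ∸ n / 2
half≤rest n = m+n≤o⇒m≤o∸n (n / 2) (≤-trans (≤-reflexive (double (n / 2))) (m/n*n≤m n 2))
  where
  double : ∀ m → m + m ≡ m * 2
  double = solve-∀

midBinom-! : ∀ n → midBinom n * ((n / 2) ! * (n ∸ n / 2) !) ≡ n !
midBinom-! n rewrite nCk≡n!/k![n-k]! (m/n≤m n 2) = m/n*n≡m {{_}} (k![n∸k]!∣n! (m/n≤m n 2))

-- This is the maximality of the middle binomial coefficient without division. The product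
-- `a ! * b !` is kept because it counts the maximal chains through a set of size `a`.
n!≤midBinom-≤ : ∀ a b → a ≤ b → (a + b) ! ≤ midBinom (a + b) * (a ! * b !)
n!≤midBinom-≤ a b ordered = begin
  (a + b) !                                  ≡⟨ midBinom-! (a + b) ⟨
  midBinom (a + b) * (h ! * q !)             ≡⟨ cong (λ x → midBinom (a + b) * (x ! * q !)) a+d ⟨
  midBinom (a + b) * ((a + d) ! * q !)       ≤⟨ *-monoʳ-≤ (midBinom (a + b)) (!-balanced a q d (≤-trans a≤h (half≤rest (a + b)))) ⟩
  midBinom (a + b) * (a ! * (q + d) !)       ≡⟨ cong (λ x → midBinom (a + b) * (a ! * x !)) q+d ⟩
  midBinom (a + b) * (a ! * b !)             ∎
  where
  open ≤-Reasoning
  h = (a + b) / 2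
  q = a + b ∸ h
  a≤h : a ≤ h
  a≤h = ≤-trans (≤-reflexive (sym (m*n/n≡m a 2))) (/-mono-≤ {n = a + b} (≤-trans (≤-reflexive (double a)) (+-monoʳ-≤ a ordered)) (≤-refl {2}))
    where
    double : ∀ m → m * 2 ≡ m + m
    double = solve-∀
  d = h ∸ a
  a+d : a + d ≡ h
  a+d = m+[n∸m]≡n a≤h
  q+d : q + d ≡ b
  q+d = +-cancelˡ-≡ a _ _ (trans (arith a q d) (trans (cong (q +_) a+d) (m∸n+n≡m (m/n≤m (a + b) 2))))
    where
    arith : ∀ a q d → a + (q + d) ≡ q + (a + d)
    arith = solve-∀

n!≤midBinom : ∀ a b → (a + b) ! ≤ midBinom (a + b) * (a ! * b !)
n!≤midBinom a b with ≤-total a b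
... | inj₁ ordered = n!≤midBinom-≤ a b ordered
... | inj₂ b≤a rewrite +-comm a b | *-comm (a !) (b !) = n!≤midBinom-≤ b a b≤a

-- Going from level `a` to the next multiplies the binomial coefficient by b/(a + 1), here at least
-- K + 1, and the result is still at most the middle one.
far-from-middle : ∀ K a b → suc K * suc a ≤ b → suc K * (a + b) ! ≤ midBinom (a + b) * (a ! * b !)
far-from-middle K a (suc b) K≤b rewrite +-suc a b = begin
  suc K * suc (a + b) !                                    ≤⟨ *-monoʳ-≤ (suc K) (n!≤midBinom (suc a) b) ⟩
  suc K * (mid * (suc a * a ! * b !))                        ≡⟨ arith (suc K) mid (suc a) (a !) (b !) ⟩
  mid * (a ! * (suc K * suc a * b !))                        ≤⟨ *-monoʳ-≤ mid (*-monoʳ-≤ (a !) (*-monoˡ-≤ (b !) K≤b)) ⟩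
  mid * (a ! * (suc b * b !))                                ∎
  where
  open ≤-Reasoning
  mid = midBinom (suc (a + b))
  arith : ∀ k m a x y → k * (m * (a * x * y)) ≡ m * (x * (k * a * y))
  arith = solve-∀

-- Chains through a set and the LYM inequality

-- For the indicator `P` of a set of size `a` this says that the chain of prefixes passes through
-- the set.
splitsAt : ℕ → (A → Bool) → List A → Bool
splitsAt zero    P []      = true
splitsAt zero    P (x ∷ l) = not (P x) ∧ splitsAt zero P l
splitsAt (suc a) P []      = false
splitsAt (suc a) P (x ∷ l) = P x ∧ splitsAt a P l

not-true : ∀ {b} → not b ≡ true → b ≡ false
not-true {false} _ = refl

splitsAt-take : ∀ a (P : A → Bool) l {x} → splitsAt a P l ≡ true → x ∈ take a l → P x ≡ true
splitsAt-take (suc a) P (y ∷ l) eq (here refl) = ∧-trueˡ eq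
splitsAt-take (suc a) P (y ∷ l) eq (there x∈)  = splitsAt-take a P l (∧-trueʳ {P y} eq) x∈

splitsAt-rest : ∀ a (P : A → Bool) l {x} → splitsAt a P l ≡ true → x ∈ l → P x ≡ true → x ∈ take a l
splitsAt-rest zero    P (y ∷ l) eq (here refl) Px with () ← trans (sym Px) (not-true (∧-trueˡ eq))
splitsAt-rest zero    P (y ∷ l) eq (there x∈)  Px = splitsAt-rest zero P l (∧-trueʳ {not (P y)} eq) x∈ Px
splitsAt-rest (suc a) P (y ∷ l) eq (here refl) Px = here refl
splitsAt-rest (suc a) P (y ∷ l) eq (there x∈)  Px = there (splitsAt-rest a P l (∧-trueʳ {P y} eq) x∈ Px)

splitsAt-zero : (P : A → Bool) (l : List A) → (∀ {x} → x ∈ l → P x ≡ false) → splitsAt zero P l ≡ true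
splitsAt-zero P []      none = refl
splitsAt-zero P (x ∷ l) none rewrite none (here refl) = splitsAt-zero P l (none ∘ there)

∑-↭ : {l m : List A} (f : A → ℕ) → l ↭ m → ∑ l f ≡ ∑ m f
∑-↭ f l↭m = sum-↭ (map⁺ f l↭m)

∑-select : (xs : List A) (f : A → ℕ) → ∑ (select xs) (λ (y , ys) → f y) ≡ ∑ xs f
∑-select []       f = refl
∑-select (x ∷ xs) f = cong (f x +_) (trans (∑-map (select xs) _ _) (∑-select xs f))

splitsAt-count : ∀ a b (P : A → Bool) (xs : List A) → length xs ≡ a + b → ∑ xs (χ ∘ P) ≡ a →
  a ! * b ! ≤ ∑ (arrangements (a + b) xs) (χ ∘ splitsAt a P)
splitsAt-count zero b P xs |xs| none = ≤-reflexive (begin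
  b ! + 0                                               ≡⟨ +-identityʳ (b !) ⟩
  b !                                                   ≡⟨ length-arrangements b xs |xs| ⟨
  length (arrangements b xs)                            ≡⟨ *-identityʳ _ ⟨
  length (arrangements b xs) * 1                        ≡⟨ ∑-const (arrangements b xs) 1 ⟨
  ∑ (arrangements b xs) (λ _ → 1)                       ≡⟨ ∑-cong (arrangements b xs) (λ {π} π∈ → cong χ (sym (splitsAt-zero P π
                                                             (λ x∈ → P-false (∈-resp-↭ (arrangements-↭ b |xs| π∈) x∈))))) ⟩
  ∑ (arrangements b xs) (χ ∘ splitsAt zero P)           ∎)
  where
  open ≡-Reasoning
  P-false : ∀ {x} → x ∈ xs → P x ≡ false
  P-false {x} x∈ with P x in Px
  ... | false = refl
  ... | true with () ← ≤-trans (subst (λ b → 1 ≤ χ b) (sym Px) ≤-refl) (≤-trans (term≤∑ (χ ∘ P) x∈) (≤-reflexive none))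
splitsAt-count (suc a) b P xs |xs| count = begin
  suc a ! * b !                                                ≡⟨ *-assoc (suc a) (a !) (b !) ⟩
  suc a * (a ! * b !)                                          ≡⟨ *-comm (suc a) _ ⟩
  a ! * b ! * suc a                                            ≡⟨ cong (a ! * b ! *_) (trans (∑-select xs (χ ∘ P)) count) ⟨
  a ! * b ! * ∑ (select xs) (λ (y , ys) → χ (P y))             ≡⟨ ∑-* (select xs) (a ! * b !) _ ⟨
  ∑ (select xs) (λ (y , ys) → a ! * b ! * χ (P y))             ≤⟨ ∑-mono (select xs) (λ {(y , ys)} sel → first y ys (select-↭ sel)) ⟩
  ∑ (select xs) (λ (y , ys) → ∑ (arrangements (a + b) ys) (λ π → χ (P y ∧ splitsAt a P π)))
                                                               ≡⟨ ∑-arrangements (a + b) xs (χ ∘ splitsAt (suc a) P) ⟨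
  ∑ (arrangements (suc a + b) xs) (χ ∘ splitsAt (suc a) P)     ∎
  where
  open ≤-Reasoning
  first : ∀ y ys → y ∷ ys ↭ xs → a ! * b ! * χ (P y) ≤ ∑ (arrangements (a + b) ys) (λ π → χ (P y ∧ splitsAt a P π))
  first y ys y∷ys↭ with P y in Py
  ... | false = ≤-trans (≤-reflexive (*-zeroʳ (a ! * b !))) z≤n
  ... | true  = ≤-trans (≤-reflexive (*-identityʳ (a ! * b !)))
                  (splitsAt-count a b P ys (suc-injective (trans (↭-length y∷ys↭) |xs|)) (suc-injective
                    (trans (cong (λ c → χ c + ∑ ys (χ ∘ P)) (sym Py)) (trans (∑-↭ (χ ∘ P) y∷ys↭) count))))

_≟ˢ_ : (S T : Subset n) → Dec (S ≡ T)
_≟ˢ_ = Vec.≡-dec _≟ᵇ_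

∑-tabulate-suc : ∀ n (f : Fin (suc n) → ℕ) → ∑ (tabulate {n = n} Fin.suc) f ≡ ∑ (allFin n) (f ∘ Fin.suc)
∑-tabulate-suc n f = cong sum (trans (map-tabulate {n = n} Fin.suc f) (sym (map-tabulate {n = n} id (f ∘ Fin.suc))))

∣∣-∑ : (S : Subset n) → ∑ (allFin n) (χ ∘ Vec.lookup S) ≡ ∣ S ∣
∣∣-∑ []                  = refl
∣∣-∑ {suc n} (true ∷ S)  = cong suc (trans (∑-tabulate-suc n _) (∣∣-∑ S))
∣∣-∑ {suc n} (false ∷ S) = trans (∑-tabulate-suc n _) (∣∣-∑ S)

splitsAt⇒toSet : ∀ a (S : Subset n) {π} → π ↭ allFin n → splitsAt a (Vec.lookup S) π ≡ true → toSet (take a π) ≡ S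
splitsAt⇒toSet a S {π} π↭ split = ⊆-antisym
  (λ x∈ → Vec.lookup⇒[]= _ S (splitsAt-take a _ π split (∈-toSet⁻ (take a π) x∈)))
  (λ x∈ → ∈-toSet⁺ (splitsAt-rest a _ π split (∈-resp-↭ (↭-sym π↭) (∈-allFin _)) (Vec.[]=⇒lookup x∈)))

occurrences≤1 : (S : Subset n) {G : List (Subset n)} → Unique G → ∑ G (λ T → χ (does (S ≟ˢ T))) ≤ 1
occurrences≤1 S {[]}    _        = z≤n
occurrences≤1 S {T ∷ G} (T∉ ∷ u) with S ≟ˢ T
... | no  _    = occurrences≤1 S u
... | yes refl = s≤s (≤-reflexive (trans (∑-cong G (λ {T} T∈ → cong χ (dec-false (S ≟ˢ T) (All.lookup T∉ T∈))))
                   (trans (∑-const G 0) (*-zeroʳ (length G)))))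

-- `θ π i` says whether the chain `π` is charged at level `lev i`, and `hits` demands a charge for
-- every member of `G` that the chain meets. A constant `θ` bounds a family on few levels; taking
-- `φ` of the prefix for `θ` compares the middle members with the count averaged above.
module LYM {n : ℕ} (G : List (Subset n)) (unique : Unique G) (lev : ℕ → ℕ) (M : ℕ) (θ : List (Fin n) → ℕ → Bool)
  (hits : ∀ {π S} → π ↭ allFin n → S ∈ G → toSet (take ∣ S ∣ π) ≡ S → ∃[ i ] i < M × lev i ≡ ∣ S ∣ × θ π i ≡ true) where

  P : List (List (Fin n))
  P = arrangements n (allFin n)

  |allFin| : length (allFin n) ≡ n
  |allFin| = length-tabulate id

  pointwise : ∀ {π} → π ↭ allFin n → ∑ G (λ S → χ (splitsAt ∣ S ∣ (Vec.lookup S) π)) ≤ ∑ (upTo M) (χ ∘ θ π)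
  pointwise {π} π↭ = begin
    ∑ G (λ S → χ (splitsAt ∣ S ∣ (Vec.lookup S) π))                                    ≤⟨ ∑-mono G found ⟩
    ∑ G (λ S → ∑ (upTo M) (λ i → χ (θ π i) * χ (does (toSet (take (lev i) π) ≟ˢ S))))  ≡⟨ ∑-swap G (upTo M) _ ⟩
    ∑ (upTo M) (λ i → ∑ G (λ S → χ (θ π i) * χ (does (toSet (take (lev i) π) ≟ˢ S))))  ≤⟨ ∑-mono (upTo M) (λ {i} _ → once i) ⟩
    ∑ (upTo M) (χ ∘ θ π)                                                               ∎
    where
    open ≤-Reasoning
    once : ∀ i → ∑ G (λ S → χ (θ π i) * χ (does (toSet (take (lev i) π) ≟ˢ S))) ≤ χ (θ π i)
    once i = ≤-trans (≤-reflexive (∑-* G (χ (θ π i)) _))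
      (≤-trans (*-monoʳ-≤ (χ (θ π i)) (occurrences≤1 (toSet (take (lev i) π)) unique)) (≤-reflexive (*-identityʳ _)))
    found : ∀ {S} → S ∈ G → χ (splitsAt ∣ S ∣ (Vec.lookup S) π) ≤
      ∑ (upTo M) (λ i → χ (θ π i) * χ (does (toSet (take (lev i) π) ≟ˢ S)))
    found {S} S∈ with splitsAt ∣ S ∣ (Vec.lookup S) π in split
    ... | false = z≤n
    ... | true with hits π↭ S∈ (splitsAt⇒toSet ∣ S ∣ S π↭ split)
    ...   | i , i<M , lev≡ , θi = ≤-trans (≤-reflexive (sym (cong₂ (λ b c → χ b * χ c) θi
              (dec-true (toSet (take (lev i) π) ≟ˢ S)
                (trans (cong (λ j → toSet (take j π)) lev≡) (splitsAt⇒toSet ∣ S ∣ S π↭ split))))))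
              (term≤∑ (λ i → χ (θ π i) * χ (does (toSet (take (lev i) π) ≟ˢ S))) (∈-upTo⁺ i<M))

  weight : Subset n → ℕ
  weight S = ∣ S ∣ ! * (n ∸ ∣ S ∣) !

  weight≤ : ∀ S → weight S ≤ ∑ P (λ π → χ (splitsAt ∣ S ∣ (Vec.lookup S) π))
  weight≤ S = subst (λ m → weight S ≤ ∑ (arrangements m (allFin n)) (λ π → χ (splitsAt ∣ S ∣ (Vec.lookup S) π))) size≡
    (splitsAt-count ∣ S ∣ (n ∸ ∣ S ∣) (Vec.lookup S) (allFin n) (trans |allFin| (sym size≡)) (∣∣-∑ S))
    where
    size≡ : ∣ S ∣ + (n ∸ ∣ S ∣) ≡ n
    size≡ = m+[n∸m]≡n (∣p∣≤n S)

  ∑-weight≤ : ∑ G weight ≤ ∑ P (λ π → ∑ (upTo M) (χ ∘ θ π))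
  ∑-weight≤ = begin
    ∑ G weight                                                      ≤⟨ ∑-mono G (λ {S} _ → weight≤ S) ⟩
    ∑ G (λ S → ∑ P (λ π → χ (splitsAt ∣ S ∣ (Vec.lookup S) π)))     ≡⟨ ∑-swap G P _ ⟩
    ∑ P (λ π → ∑ G (λ S → χ (splitsAt ∣ S ∣ (Vec.lookup S) π)))     ≤⟨ ∑-mono P (λ π∈ → pointwise (arrangements-↭ n |allFin| π∈)) ⟩
    ∑ P (λ π → ∑ (upTo M) (χ ∘ θ π))                                ∎
    where open ≤-Reasoning

  size≤ : ∀ K → (∀ {S} → S ∈ G → K * n ! ≤ midBinom n * weight S) →
    K * length G * n ! ≤ midBinom n * ∑ P (λ π → ∑ (upTo M) (χ ∘ θ π))
  size≤ K heavy = begin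
    K * length G * n !                     ≡⟨ arith K (length G) (n !) ⟩
    length G * (K * n !)                   ≡⟨ ∑-const G (K * n !) ⟨
    ∑ G (λ _ → K * n !)                    ≤⟨ ∑-mono G heavy ⟩
    ∑ G (λ S → midBinom n * weight S)      ≡⟨ ∑-* G (midBinom n) weight ⟩
    midBinom n * ∑ G weight                ≤⟨ *-monoʳ-≤ (midBinom n) ∑-weight≤ ⟩
    midBinom n * ∑ P (λ π → ∑ (upTo M) (χ ∘ θ π))  ∎
    where
    open ≤-Reasoning
    arith : ∀ k l m → k * l * m ≡ l * (k * m)
    arith = solve-∀

-- A chain meets at most one member on each of the `M` levels, and the last hypothesis says that
-- each such level has at most `midBinom n` / K sets.
few-on-levels : (G : List (Subset n)) → Unique G → (lev : ℕ → ℕ) (K M : ℕ) →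
  (∀ {S} → S ∈ G → ∃[ i ] i < M × lev i ≡ ∣ S ∣) →
  (∀ {S} → S ∈ G → K * n ! ≤ midBinom n * (∣ S ∣ ! * (n ∸ ∣ S ∣) !)) →
  K * length G ≤ midBinom n * M
few-on-levels {n} G unique lev K M on heavy = *-cancelʳ-≤ _ _ (n !) {{n !≢0}} (begin
  K * length G * n !                                         ≤⟨ size≤ K heavy ⟩
  midBinom n * ∑ P (λ π → ∑ (upTo M) (λ _ → 1))              ≡⟨ cong (midBinom n *_) (trans (∑-const P _)
    (cong₂ _*_ (length-arrangements n (allFin n) |allFin|) (trans (∑-const (upTo M) 1) (trans (*-identityʳ _) (length-upTo M))))) ⟩
  midBinom n * (n ! * M)                                     ≡⟨ arith (midBinom n) (n !) M ⟩
  midBinom n * M * n !                                       ∎)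
  where
  open ≤-Reasoning
  hits : ∀ {π S} → π ↭ allFin n → S ∈ G → toSet (take ∣ S ∣ π) ≡ S → ∃[ i ] i < M × lev i ≡ ∣ S ∣ × true ≡ true
  hits _ S∈ _ = let i , i<M , eq = on S∈ in i , i<M , eq , refl
  open LYM G unique lev M (λ _ _ → true) hits
  arith : ∀ b m k → b * (m * k) ≡ b * k * m
  arith = solve-∀

-- The middle layer and the lower bound

layer : ∀ n → ℕ → List (Subset n)
layer zero    zero    = [] ∷ []
layer zero    (suc k) = []
layer (suc n) zero    = map (false ∷_) (layer n zero)
layer (suc n) (suc k) = map (true ∷_) (layer n k) ++ map (false ∷_) (layer n (suc k))

nC0≡1 : ∀ n → n C 0 ≡ 1
nC0≡1 n = trans (nCk≡nC[n∸k] {0} {n} z≤n) (nCn≡1 n)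

length-layer : ∀ n k → length (layer n k) ≡ n C k
length-layer zero    zero    = refl
length-layer zero    (suc k) = sym (k>n⇒nCk≡0 {0} {suc k} (s≤s z≤n))
length-layer (suc n) zero    = trans (length-map _ (layer n zero)) (trans (length-layer n zero) (trans (nC0≡1 n) (sym (nC0≡1 (suc n)))))
length-layer (suc n) (suc k) = begin
  length (map (true ∷_) (layer n k) ++ map (false ∷_) (layer n (suc k)))   ≡⟨ length-++ (map (true ∷_) (layer n k)) ⟩
  length (map (true ∷_) (layer n k)) + length (map (false ∷_) (layer n (suc k)))
    ≡⟨ cong₂ _+_ (trans (length-map _ (layer n k)) (length-layer n k)) (trans (length-map _ (layer n (suc k))) (length-layer n (suc k))) ⟩
  n C k + n C suc k                                                        ≡⟨ nCk+nC[k+1]≡[n+1]C[k+1] n k ⟩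
  suc n C suc k                                                            ∎
  where open ≡-Reasoning

layer-unique : ∀ n k → Unique (layer n k)
layer-unique zero    zero    = [] ∷ []
layer-unique zero    (suc k) = []
layer-unique (suc n) zero    = Unique.map⁺ Vec.∷-injectiveʳ (layer-unique n zero)
layer-unique (suc n) (suc k) = Unique.++⁺ (Unique.map⁺ Vec.∷-injectiveʳ (layer-unique n k)) (Unique.map⁺ Vec.∷-injectiveʳ (layer-unique n (suc k)))
  λ (in₁ , in₂) → disjoint (∈-map⁻ (true ∷_) in₁) (∈-map⁻ (false ∷_) in₂)
  where
  disjoint : ∀ {S : Subset (suc n)} → ∃[ T ] T ∈ layer n k × S ≡ true ∷ T → ∃[ T ] T ∈ layer n (suc k) × S ≡ false ∷ T → ⊥
  disjoint (_ , _ , refl) (_ , _ , ())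

layer-size : ∀ n k {S} → S ∈ layer n k → ∣ S ∣ ≡ k
layer-size zero    zero    (here refl) = refl
layer-size (suc n) zero    S∈ with ∈-map⁻ (false ∷_) S∈
... | T , T∈ , refl = layer-size n zero T∈
layer-size (suc n) (suc k) S∈ with ∈-++⁻ (map (true ∷_) (layer n k)) S∈
... | inj₁ S∈₁ with ∈-map⁻ (true ∷_) S∈₁
...   | T , T∈ , refl = cong suc (layer-size n k T∈)
layer-size (suc n) (suc k) S∈ | inj₂ S∈₂ with ∈-map⁻ (false ∷_) S∈₂
...   | T , T∈ , refl = layer-size n (suc k) T∈

⊆-same-size : (S T : Subset n) → S ⊆ T → ∣ S ∣ ≡ ∣ T ∣ → S ≡ T
⊆-same-size []          []          S⊆T eq = refl
⊆-same-size (true ∷ S)  (true ∷ T)  S⊆T eq = cong (true ∷_) (⊆-same-size S T (drop-∷-⊆ S⊆T) (suc-injective eq))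
⊆-same-size (false ∷ S) (false ∷ T) S⊆T eq = cong (false ∷_) (⊆-same-size S T (drop-∷-⊆ S⊆T) eq)
⊆-same-size (true ∷ S)  (false ∷ T) S⊆T eq with () ← S⊆T Vec.here
⊆-same-size (false ∷ S) (true ∷ T)  S⊆T eq = ⊥-elim (<-irrefl eq (s≤s (p⊆q⇒∣p∣≤∣q∣ (drop-∷-⊆ S⊆T))))

lookup-injective : {l : List A} → Unique l → ∀ i j → lookup l i ≡ lookup l j → i ≡ j
lookup-injective (x∉ ∷ u) Fin.zero    Fin.zero    eq = refl
lookup-injective (x∉ ∷ u) Fin.zero    (Fin.suc j) eq = ⊥-elim (All.lookup x∉ (∈-lookup j) eq)
lookup-injective (x∉ ∷ u) (Fin.suc i) Fin.zero    eq = ⊥-elim (All.lookup x∉ (∈-lookup i) (sym eq))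
lookup-injective (x∉ ∷ u) (Fin.suc i) (Fin.suc j) eq = cong Fin.suc (lookup-injective u i j eq)

middleLayer : ∀ n → Family n
middleLayer n = family (layer n (n / 2)) (layer-unique n (n / 2))

-- Nested sets of equal size coincide, so already one relation of the crown contradicts injectivity.
middleLayer-crownFree : ∀ n {t} → 1 ≤ t → CrownFree t (middleLayer n)
middleLayer-crownFree n {suc t} _ (f , f-injective , f-mono) with f-injective {inj₁ Fin.zero} {inj₂ Fin.zero}
  (lookup-injective (layer-unique n (n / 2)) _ _ (⊆-same-size _ _ (f-mono _ _ (a≤b Fin.zero))
    (trans (size≡ (inj₁ Fin.zero)) (sym (size≡ (inj₂ Fin.zero))))))
  where
  size≡ : ∀ u → ∣ member (middleLayer n) (f u) ∣ ≡ n / 2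
  size≡ u = layer-size n (n / 2) (∈-lookup (f u))
... | ()

-- Assembling the upper bound

length-filter-split : {Q : A → Set} (Q? : ∀ x → Dec (Q x)) (l : List A) →
  length l ≡ length (filter Q? l) + length (filter (¬? ∘ Q?) l)
length-filter-split Q? []      = refl
length-filter-split Q? (x ∷ l) with Q? x
... | yes _ = cong suc (length-filter-split Q? l)
... | no  _ = trans (cong suc (length-filter-split Q? l)) (sym (+-suc _ _))

does⁻ : {Q : Set} (Q? : Dec Q) → does Q? ≡ true → Q
does⁻ (yes q) _ = q

length-allFin : ∀ n → length (allFin n) ≡ n
length-allFin n = length-tabulate id

unique-arrangement : ∀ {n} {π : List (Fin n)} → π ↭ allFin n → Unique π
unique-arrangement {n} π↭ = Unique-resp-↭ (setoid (Fin n)) (↭⇒↭ₛ (↭-sym π↭)) (Unique.allFin⁺ n)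

module CrownFreeLevels {n : ℕ} (d : Fin n) (F : Family n) (φ : List (Fin n) → Bool) (φ-↭ : ∀ {l m} → l ↭ m → φ l ≡ φ m)
  (r L : ℕ) (r≤ : ∀ l → φ l ≡ true → r ≤ length l) (≤L : ∀ l → φ l ≡ true → length l ≤ L)
  (φ⇒∈ : ∀ l → φ l ≡ true → toSet l ∈ sets F) (s t : ℕ) (t≡ : t ≡ suc (Walk.last s)) (free : CrownFree t F) where

  open Averaging φ φ-↭ r L r≤ ≤L
  open Grids φ φ-↭ r L r≤ ≤L
  open GridCrown F φ φ-↭ r L r≤ ≤L φ⇒∈

  levels≤ : ∀ π → π ↭ allFin n → levels π ≤ t + t
  levels≤ π π↭ with t + t ≤? levels π
  ... | no  few  = <⇒≤ (≰⇒> few)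
  ... | yes many with choose (t + t) (length π) (λ j → φ (take (suc j) π)) many
  ...   | ι , ok , mono = ⊥-elim (CrownIn⇒¬CrownFree
            (chain⇒crown d {F} π (unique-arrangement π↭) ι
              (λ {i} i< → proj₁ (ok i<) , φ⇒∈ (take (suc (ι i)) π) (proj₂ (ok i<))) mono) free)

  grid-free : ∀ {π} → π ↭ allFin n → ¬ Grid d t π
  grid-free {π} π↭ grid = CrownIn⇒¬CrownFree (subst (λ t → CrownIn t F) (sym t≡)
    (grid⇒crown s d π (unique-arrangement π↭) (subst (λ t → Grid d t π) t≡ grid))) free

  sparse : ∀ E M₁ M₂ M₃ → ForcesTripartite (r * (r * (r * r))) t M₁ M₂ M₃ → n ≡ L + M₁ + M₂ + M₃ →
    r ≤ n → 1 ≤ E * (t + t) → r ≡ 4 * (E * (t + t)) →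
    ¬ (suc E * n ! ≤ E * ∑ (arrangements n (allFin n)) (λ π → ∑ (upTo (suc n)) (λ j → χ (φ (take j π)))))
  sparse E M₁ M₂ M₃ forces n≡ r≤n 1≤EH r≡ dense =
    let π , π↭ , grid = good-dense⇒Grid d {r * (r * (r * r))} {t} {M₁} {M₂} {M₃} n (allFin n) (length-allFin n) forces n≡
          (good-dense n (allFin n) (length-allFin n) (t + t) r≤n levels≤ E 1≤EH r≡ dense)
    in  grid-free π↭ grid

-- The excess to refute is 1/(k + 1) = 2/E of the middle binomial coefficient: a share 1/E pays for
-- the members of extreme size, the other 1/E is the excess on the middle levels. `r` comes from
-- `good-dense` with 2t as the bound for members on a chain. There are `W` extreme levels, each with
-- at most `mid` / (K + 1) sets, and K = E·W brings their total down to `mid` / E.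
module UpperBound (s t k E r M₁ M₂ M₃ K : ℕ) (t≡ : t ≡ suc (Walk.last s)) (E≡ : E ≡ 2 * suc k)
  (r≡ : r ≡ 4 * (E * (t + t))) (K≡ : K ≡ E * (r + (M₁ + M₂ + M₃)))
  (forces : ForcesTripartite (r * (r * (r * r))) t M₁ M₂ M₃) where

  M W threshold : ℕ
  M = M₁ + M₂ + M₃
  W = r + M
  -- For such n a level a < W satisfies (K + 1)·(a + 1) ≤ n - a, as `far-from-middle` requires.
  threshold = suc K * W + W

  1≤EH : 1 ≤ E * (t + t)
  1≤EH = *-mono-≤ {1} {E} {1} {t + t} (subst (1 ≤_) (sym E≡) (s≤s z≤n)) (subst (λ t → 1 ≤ t + t) (sym t≡) (s≤s z≤n))

  1≤r : 1 ≤ r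
  1≤r = ≤-trans 1≤EH (≤-trans (m≤m+n (E * (t + t)) _) (≤-reflexive (sym r≡)))

  module _ (n : ℕ) (large : threshold ≤ n) (F : Family n) (free : CrownFree t F) where

    mid L : ℕ
    mid = midBinom n
    L = n ∸ M

    W≤n : W ≤ n
    W≤n = ≤-trans (m≤n+m W (suc K * W)) large

    0<n : 0 < n
    0<n = ≤-trans 1≤r (≤-trans (m≤m+n r M) W≤n)

    0<mid : 0 < mid
    0<mid with mid | n!≤midBinom 0 n
    ... | zero  | n!≤0 = ⊥-elim (<⇒≱ (>-nonZero⁻¹ (n !) {{n !≢0}}) n!≤0)
    ... | suc _ | _    = s≤s z≤n

    extreme-weight : ∀ {a b} → a < W → a + b ≡ n → suc K * n ! ≤ mid * (a ! * b !)
    extreme-weight {a} {b} a<W refl = far-from-middle K a b (+-cancelˡ-≤ a _ _ (begin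
      a + suc K * suc a    ≤⟨ +-mono-≤ (<⇒≤ a<W) (*-monoʳ-≤ (suc K) a<W) ⟩
      W + suc K * W        ≡⟨ +-comm W _ ⟩
      suc K * W + W        ≤⟨ large ⟩
      a + b                ∎))
      where open ≤-Reasoning

    low? : ∀ (S : Subset n) → Dec (∣ S ∣ < r)
    low? S = ∣ S ∣ <? r

    high? : ∀ (S : Subset n) → Dec (n ∸ ∣ S ∣ < M)
    high? S = n ∸ ∣ S ∣ <? M

    lows rest highs middles : List (Subset n)
    lows    = filter low? (sets F)
    rest    = filter (¬? ∘ low?) (sets F)
    highs   = filter high? rest
    middles = filter (¬? ∘ high?) rest

    rest-unique : Unique rest
    rest-unique = Unique.filter⁺ (¬? ∘ low?) (unique F)

    size≡ : size F ≡ (length lows + length highs) + length middles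
    size≡ = trans (length-filter-split low? (sets F))
      (trans (cong (length lows +_) (length-filter-split high? rest)) (sym (+-assoc (length lows) _ _)))

    lows≤ : suc K * length lows ≤ mid * r
    lows≤ = few-on-levels lows (Unique.filter⁺ low? (unique F)) id (suc K) r
      (λ S∈ → _ , low S∈ , refl) (λ {S} S∈ → extreme-weight (<-≤-trans (low S∈) (m≤m+n r M)) (m+[n∸m]≡n (∣p∣≤n S)))
      where
      low : ∀ {S} → S ∈ lows → ∣ S ∣ < r
      low S∈ = proj₂ (∈-filter⁻ low? {xs = sets F} S∈)

    highs≤ : suc K * length highs ≤ mid * M
    highs≤ = few-on-levels highs (Unique.filter⁺ high? rest-unique) (n ∸_) (suc K) M
      (λ {S} S∈ → n ∸ ∣ S ∣ , high S∈ , m∸[m∸n]≡n (∣p∣≤n S))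
      (λ {S} S∈ → ≤-trans (extreme-weight (<-≤-trans (high S∈) (m≤n+m M r)) (m∸n+n≡m (∣p∣≤n S)))
        (≤-reflexive (cong (mid *_) (*-comm ((n ∸ ∣ S ∣) !) (∣ S ∣ !)))))
      where
      high : ∀ {S} → S ∈ highs → n ∸ ∣ S ∣ < M
      high S∈ = proj₂ (∈-filter⁻ high? {xs = rest} S∈)

    extremes≤ : E * (length lows + length highs) ≤ mid
    extremes≤ = *-cancelʳ-≤ _ _ W {{>-nonZero (≤-trans 1≤r (m≤m+n r M))}} (begin
      E * (length lows + length highs) * W                 ≡⟨ trans (arith₁ E W (length lows) (length highs)) (cong (λ K → K * length lows + K * length highs) (sym K≡)) ⟩
      K * length lows + K * length highs                   ≤⟨ +-mono-≤ (m≤n+m _ (length lows)) (m≤n+m _ (length highs)) ⟩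
      suc K * length lows + suc K * length highs           ≤⟨ +-mono-≤ lows≤ highs≤ ⟩
      mid * r + mid * M                                        ≡⟨ *-distribˡ-+ mid r M ⟨
      mid * W                                                ∎)
      where
      open ≤-Reasoning
      arith₁ : ∀ e w a b → e * (a + b) * w ≡ e * w * a + e * w * b
      arith₁ = solve-∀

    open DecMembership (_≟ˢ_ {n}) using (_∈?_)

    φ : List (Fin n) → Bool
    φ l = does (toSet l ∈? sets F) ∧ (does (r ≤? length l) ∧ does (length l ≤? L))

    φ-↭ : ∀ {l m} → l ↭ m → φ l ≡ φ m
    φ-↭ l↭m = cong₂ (λ S j → does (S ∈? sets F) ∧ (does (r ≤? j) ∧ does (j ≤? L))) (toSet-↭ l↭m) (↭-length l↭m)

    φ⇒∈ : ∀ l → φ l ≡ true → toSet l ∈ sets F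
    φ⇒∈ l φl = does⁻ (toSet l ∈? sets F) (∧-trueˡ φl)

    φ⇒r≤ : ∀ l → φ l ≡ true → r ≤ length l
    φ⇒r≤ l φl = does⁻ (r ≤? length l) (∧-trueˡ (∧-trueʳ {does (toSet l ∈? sets F)} φl))

    φ⇒≤L : ∀ l → φ l ≡ true → length l ≤ L
    φ⇒≤L l φl = does⁻ (length l ≤? L) (∧-trueʳ {does (r ≤? length l)} (∧-trueʳ {does (toSet l ∈? sets F)} φl))

    hits : ∀ {π S} → π ↭ allFin n → S ∈ middles → toSet (take ∣ S ∣ π) ≡ S →
      ∃[ i ] i < suc n × i ≡ ∣ S ∣ × φ (take i π) ≡ true
    hits {π} {S} π↭ S∈ eq with ∈-filter⁻ (¬? ∘ high?) {xs = rest} S∈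
    ... | S∈rest , ¬high with ∈-filter⁻ (¬? ∘ low?) {xs = sets F} S∈rest
    ...   | S∈F , ¬low = ∣ S ∣ , s≤s (∣p∣≤n S) , refl , ∧-true
      (dec-true (toSet (take ∣ S ∣ π) ∈? sets F) (subst (_∈ sets F) (sym eq) S∈F)) (∧-true
      (dec-true (r ≤? length (take ∣ S ∣ π)) (subst (r ≤_) (sym len) (≮⇒≥ ¬low)))
      (dec-true (length (take ∣ S ∣ π) ≤? L) (subst (_≤ L) (sym len) ∣S∣≤L)))
      where
      len : length (take ∣ S ∣ π) ≡ ∣ S ∣
      len = trans (length-take ∣ S ∣ π) (m≤n⇒m⊓n≡m (≤-trans (∣p∣≤n S) (≤-reflexive (sym (trans (↭-length π↭) (length-allFin n))))))
      ∣S∣≤L : ∣ S ∣ ≤ L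
      ∣S∣≤L = m+n≤o⇒m≤o∸n ∣ S ∣ (≤-trans (+-monoʳ-≤ ∣ S ∣ (≮⇒≥ ¬high)) (≤-reflexive (m+[n∸m]≡n (∣p∣≤n S))))

    X : ℕ
    X = ∑ (arrangements n (allFin n)) (λ π → ∑ (upTo (suc n)) (λ j → χ (φ (take j π))))

    middles≤ : length middles * n ! ≤ mid * X
    middles≤ = ≤-trans (≤-reflexive (cong (_* n !) (sym (*-identityˡ (length middles)))))
      (size≤ 1 (λ {S} _ → begin
        1 * n !                              ≡⟨ *-identityˡ (n !) ⟩
        n !                                  ≡⟨ cong _! (m+[n∸m]≡n (∣p∣≤n S)) ⟨
        (∣ S ∣ + (n ∸ ∣ S ∣)) !              ≤⟨ n!≤midBinom ∣ S ∣ (n ∸ ∣ S ∣) ⟩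
        midBinom (∣ S ∣ + (n ∸ ∣ S ∣)) * weight S  ≡⟨ cong (λ m → midBinom m * weight S) (m+[n∸m]≡n (∣p∣≤n S)) ⟩
        mid * weight S                         ∎))
      where
      open ≤-Reasoning
      open LYM middles (Unique.filter⁺ (¬? ∘ high?) rest-unique) id (suc n) (λ π i → φ (take i π)) hits

    n≡ : n ≡ L + M₁ + M₂ + M₃
    n≡ = trans (sym (m∸n+n≡m (≤-trans (m≤n+m M r) W≤n))) (arith L M₁ M₂ M₃)
      where
      arith : ∀ l a b c → l + (a + b + c) ≡ l + a + b + c
      arith = solve-∀

    few-levels : ¬ (suc E * n ! ≤ E * X)
    -- The element of `Fin n` is the default value of `at`; the grid positions that are read all lie
    -- inside the arrangement.
    few-levels = CrownFreeLevels.sparse (Fin.fromℕ< 0<n) F φ φ-↭ r L φ⇒r≤ φ⇒≤L φ⇒∈ s t t≡ free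
      E M₁ M₂ M₃ forces n≡ (≤-trans (m≤m+n r M) W≤n) 1≤EH r≡

    upper-bound : suc k * size F ≤ suc (suc k) * mid
    upper-bound with suc k * size F ≤? suc (suc k) * mid
    ... | yes ok    = ok
    ... | no  large = ⊥-elim (few-levels (*-cancelʳ-≤ _ _ mid {{>-nonZero 0<mid}} (begin
      suc E * n ! * mid                    ≡⟨ arith₁ (suc E) (n !) mid ⟩
      suc E * mid * n !                    ≤⟨ *-monoˡ-≤ (n !) many-middles ⟩
      E * length middles * n !           ≡⟨ *-assoc E (length middles) (n !) ⟩
      E * (length middles * n !)         ≤⟨ *-monoʳ-≤ E middles≤ ⟩
      E * (mid * X)                        ≡⟨ arith₂ E mid X ⟩
      E * X * mid                          ∎)))
      where
      open ≤-Reasoning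
      arith₁ : ∀ e m b → e * m * b ≡ e * b * m
      arith₁ = solve-∀
      arith₂ : ∀ e b x → e * (b * x) ≡ e * x * b
      arith₂ = solve-∀
      arith₃ : ∀ k b → b + suc (2 * suc k) * b ≡ 2 * (suc (suc k) * b)
      arith₃ = solve-∀
      -- Too large a family gives E·|F| ≥ (E + 2)·`mid`, and the extreme members account for at most
      -- one `mid` of it.
      many-middles : suc E * mid ≤ E * length middles
      many-middles = +-cancelˡ-≤ mid _ _ (begin
        mid + suc E * mid                                                    ≡⟨ trans (cong (λ E → mid + suc E * mid) E≡) (arith₃ k mid) ⟩
        2 * (suc (suc k) * mid)                                            ≤⟨ *-monoʳ-≤ 2 (<⇒≤ (≰⇒> large)) ⟩
        2 * (suc k * size F)                                             ≡⟨ trans (cong (_* size F) E≡) (*-assoc 2 (suc k) (size F)) ⟨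
        E * size F                                                       ≡⟨ cong (E *_) size≡ ⟩
        E * ((length lows + length highs) + length middles)              ≡⟨ *-distribˡ-+ E (length lows + length highs) _ ⟩
        E * (length lows + length highs) + E * length middles            ≤⟨ +-monoˡ-≤ _ extremes≤ ⟩
        mid + E * length middles                                           ∎)

-- The asymptotics for odd t from 7 on

odd≥7 : ∀ {t} → (∃ λ m → t ≡ suc (2 * m)) → 7 ≤ t → ∃[ s ] t ≡ suc (Walk.last s)
odd≥7 (zero , refl)                    (s≤s ())
odd≥7 (suc zero , refl)                (s≤s (s≤s (s≤s ())))
odd≥7 (suc (suc zero) , refl)          (s≤s (s≤s (s≤s (s≤s (s≤s ())))))
odd≥7 (suc (suc (suc s)) , refl) _     = s , cong suc (arith s)
  where
  arith : ∀ s → 2 * (3 + s) ≡ 2 + ((2 + s) + (2 + s))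
  arith = solve-∀

-- The term o(1) is expressed by an error of 1/(k + 1) on either side. The constants depend on each
-- other in one direction: `r` on k and t, the block sizes on `r` and t, and the threshold for n on
-- all of these. The middle layer meets the lower bound for every n.
crown-asymptotics : ∀ s t k E r → t ≡ suc (Walk.last s) → E ≡ 2 * suc k → r ≡ 4 * (E * (t + t)) →
  ∃ λ N → (n : ℕ) → N ≤ n →
    ((F : Family n) → CrownFree t F → suc k * size F ≤ suc (suc k) * midBinom n)
    × (Σ (Family n) λ F → CrownFree t F × (k * midBinom n ≤ suc k * size F))
crown-asymptotics s t k E r t≡ E≡ r≡ = with-parts
  (subst (λ t → ∃[ M₁ ] ∃[ M₂ ] ∃[ M₃ ] ForcesTripartite (r * (r * (r * r))) t M₁ M₂ M₃) (sym t≡)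
    (dense⇒tripartite (r * (r * (r * r))) (Walk.last s) (*-mono-≤ 1≤r (*-mono-≤ 1≤r (*-mono-≤ 1≤r 1≤r)))))
  where
  1≤t : 1 ≤ t
  1≤t = subst (1 ≤_) (sym t≡) (s≤s z≤n)
  1≤r : 1 ≤ r
  1≤r = subst (1 ≤_) (sym r≡) (*-mono-≤ {1} {4} (s≤s z≤n)
    (*-mono-≤ (subst (1 ≤_) (sym E≡) (s≤s z≤n)) (≤-trans 1≤t (m≤m+n t t))))
  with-parts : (∃[ M₁ ] ∃[ M₂ ] ∃[ M₃ ] ForcesTripartite (r * (r * (r * r))) t M₁ M₂ M₃) → _
  with-parts (M₁ , M₂ , M₃ , forces) = threshold , λ n N≤n →
    upper-bound n N≤n ,
    (middleLayer n , middleLayer-crownFree n 1≤t ,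
     *-mono-≤ (n≤1+n k) (≤-reflexive (sym (length-layer n (n / 2)))))
    where open UpperBound s t k E r M₁ M₂ M₃ (E * (r + (M₁ + M₂ + M₃))) t≡ E≡ r≡ refl forces

theorem1 : (t : ℕ) → 7 ≤ t → (∃ λ m → t ≡ suc (2 * m)) →
    (k : ℕ) → ∃ λ N → (n : ℕ) → N ≤ n →
    ((F : Family n) → CrownFree t F →
    suc k * size F ≤ suc (suc k) * midBinom n)
    × (Σ (Family n) λ F → CrownFree t F × (k * midBinom n ≤ suc k * size F))
theorem1 t 7≤t t-odd k =
  let s , t≡ = odd≥7 t-odd 7≤t
  in  crown-asymptotics s t k (2 * suc k) (4 * (2 * suc k * (t + t))) t≡ refl refl
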